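{- Let $n\ge1$. The set $$\mathcal{D}_n=\big\{\Delta_{C(\alpha)} : \alpha\in\{0,1\}^n \text{ a ballot sequence}\big\}$$ is contained in $EQH_n$ and is linearly independent (with the elements $\Delta_{C(\alpha)}$ indexed by the ballot sequences $\alpha$).
   Context: Let $R_n=\mathbb{Q}[\theta_1,\dots,\theta_n]$ be the polynomial ring in anticommuting variables over $\mathbb{Q}$ (exterior algebra): $\theta_i\theta_j=-\theta_j\theta_i$ for $i\ne j$, $\theta_i^2=0$. For $A=\{a_1<\cdots<a_r\}\subseteq[n]$ put $\theta_A=\theta_{a_1}\cdots\theta_{a_r}$, and $F_{1^r}=\sum_{A\subseteq[n],|A|=r}\theta_A$. Let $I_n$ be the ideal of $R_n$ generated by $F_{1^r}$, $1\le r\le n$. Operators $\partial_{\theta_i}$ on $R_n$: $\partial_{\theta_i}(\theta_A)=(-1)^{\#\{j\in A: j<i\}}\theta_{A\setminus\{i\}}$ if $i\in A$, and $0$ otherwise. The inner product on $R_n$ is $\langle p,q\rangle=\overline{p(\partial_{\theta_1},\dots,\partial_{\theta_n})}\,q(\theta_1,\dots,\theta_n)|_{\theta_1=\cdots=\theta_n=0}$, where the bar reverses the order of the factors in every monomial; the monomials $\theta_A$ are an orthonormal basis for it. Define $EQH_n=\{q\in R_n:\langle p,q\rangle=0\text{ for all }p\in I_n\}$. A ballot sequence is $\alpha=(a_1,\dots,a_n)\in\{0,1\}^n$ with $\sum_{i=1}^r a_i\le r/2$ for all $1\le r\le n$. Given a ballot sequence $\alpha$, replace each $0$ by an open parenthesis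 and each $1$ by a closing parenthesis and perform the usual maximal matching of parentheses (every closing parenthesis gets matched; some open ones may remain unmatched). Let $C(\alpha)=((i_1,j_1),\dots,(i_k,j_k))$ be the list of matched pairs of positions ($i_r<j_r$, $i_r$ the open and $j_r$ the closing parenthesis), ordered so that $j_1<j_2<\cdots<j_k$. E.g. $\alpha=0010001101$ gives $C(\alpha)=((2,3),(6,7),(5,8),(9,10))$. Define $\Delta_{C(\alpha)}=(\theta_{j_1}-\theta_{i_1})(\theta_{j_2}-\theta_{i_2})\cdots(\theta_{j_k}-\theta_{i_k})$, with $\Delta_{C(\alpha)}=1$ if $k=0$. -}

module Defs where

open import Data.Bool using (true; false; if_then_else_) renaming (_≟_ to _≟ᵇ_)
open import Data.Fin using (Fin; toℕ; _<?_)
open import Data.Fin.Patterns using (0F; 1F)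
open import Data.Fin.Subset using (Subset; inside; outside; ⊥; ⁅_⁆; _∩_; _∪_; ∣_∣)
  renaming (_-_ to _∖_)
open import Data.Fin.Subset.Properties using (_∈?_; nonempty?)
open import Data.List as List using (List; []; _∷_; _++_)
open import Data.List.Membership.Propositional using () renaming (_∈_ to _∈ˡ_)
open import Data.List.Relation.Unary.Unique.Propositional using (Unique)
open import Data.Nat using (ℕ; zero; suc; _≤_; _≟_) renaming (_*_ to _*ℕ_)
open import Data.Nat.ListAction using (sum)
open import Data.Product using (_×_; _,_; ∃-syntax)
open import Data.Rational using (ℚ; 0ℚ; 1ℚ; _+_; _*_; _-_; -_)
open import Data.Refinement using (Refinement-syntax; value)
open import Data.Vec as Vec using (Vec; lookup; toList)
open import Data.Vec.Properties using (≡-dec)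
open import Level using (0ℓ)
open import Relation.Binary.PropositionalEquality using (_≡_; _≗_)
open import Relation.Nullary using (does)
open import Relation.Unary using (Pred)

private
  variable
    n : ℕ

------------------------------------------------------------------------
-- The exterior algebra

-- An element of ℚ[θ₁,…,θₙ] is given by its coefficients in the monomial
-- basis (θ_A), A ⊆ [n]; equality of elements is pointwise equality _≗_.
-- The variables are indexed from 0, by Fin n.
R : ℕ → Set
R n = Subset n → ℚ

infixl 6 _⊕_ _⊖_
infixr 7 _·_
infixl 7 _⊗_

𝟎 : R n
𝟎 _ = 0ℚ

_⊕_ : R n → R n → R n
(p ⊕ q) S = p S + q S

_⊖_ : R n → R n → R n
(p ⊖ q) S = p S - q S

_·_ : ℚ → R n → R n
(c · p) S = c * p S

∑ : {I : Set} → List I → (I → R n) → R n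
∑ xs v = List.foldr (λ x p → v x ⊕ p) 𝟎 xs

subsets : ∀ n → List (Subset n)
subsets zero    = Vec.[] ∷ []
subsets (suc n) =
  List.map (outside Vec.∷_) (subsets n) ++ List.map (inside Vec.∷_) (subsets n)

θ[_] : Subset n → R n
θ[ A ] S = if does (≡-dec _≟ᵇ_ A S) then 1ℚ else 0ℚ

𝟏 : R n
𝟏 = θ[ ⊥ ]

θ : Fin n → R n
θ i = θ[ ⁅ i ⁆ ]

-- In increasing order.
elements : Subset n → List (Fin n)
elements {n} A = List.filter (_∈? A) (List.allFin n)

#below : Fin n → Subset n → ℕ
#below i A = List.length (List.filter (_<? i) (elements A))

-1^_ : ℕ → ℚ
-1^ zero  = 1ℚ
-1^ suc k = - (-1^ k)

-- The number of pairs (i , j) with i ∈ A, j ∈ B and j < i, i.e. of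
-- transpositions needed to sort the word θ_A θ_B.
inversions : Subset n → Subset n → ℕ
inversions A B = sum (List.map (λ i → #below i B) (elements A))

monomialProduct : Subset n → Subset n → R n
monomialProduct A B =
  if does (nonempty? (A ∩ B)) then 𝟎 else (-1^ inversions A B) · θ[ A ∪ B ]

_⊗_ : R n → R n → R n
_⊗_ {n} p q =
  ∑ (subsets n) λ A → ∑ (subsets n) λ B → (p A * q B) · monomialProduct A B

------------------------------------------------------------------------
-- The ideal Iₙ

F : ℕ → R n
F {n} r = ∑ (List.filter (λ A → ∣ A ∣ ≟ r) (subsets n)) θ[_]

-- The two-sided ideal generated by F 1, …, F n.
data I (n : ℕ) : Pred (R n) 0ℓ where
  generator : ∀ r → 1 ≤ r → r ≤ n → I n (F r)
  zero      : I n 𝟎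
  add       : ∀ {p q} → I n p → I n q → I n (p ⊕ q)
  mulˡ      : ∀ s {p} → I n p → I n (s ⊗ p)
  mulʳ      : ∀ s {p} → I n p → I n (p ⊗ s)
  resp      : ∀ {p q} → p ≗ q → I n p → I n q

------------------------------------------------------------------------
-- The inner product and EQHₙ

∂-monomial : Fin n → Subset n → R n
∂-monomial i A =
  if does (i ∈? A) then (-1^ #below i A) · θ[ A ∖ i ] else 𝟎

∂ : Fin n → R n → R n
∂ {n} i q = ∑ (subsets n) λ A → q A · ∂-monomial i A

-- The word i₁ i₂ … iₖ acts as the composite ∂ i₁ ∘ ∂ i₂ ∘ … ∘ ∂ iₖ.
∂-word : List (Fin n) → R n → R n
∂-word w q = List.foldr ∂ q w

-- The operator obtained from p by reversing the factors of each monomial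
-- and substituting ∂ i for θ i.
reversed-at-∂ : R n → R n → R n
reversed-at-∂ {n} p q =
  ∑ (subsets n) λ A → p A · ∂-word (List.reverse (elements A)) q

-- Setting all θ i to 0 leaves the coefficient of θ_∅.
⟨_,_⟩ : R n → R n → ℚ
⟨ p , q ⟩ = reversed-at-∂ p q ⊥

EQH : ∀ n → Pred (R n) 0ℓ
EQH n q = ∀ p → I n p → ⟨ p , q ⟩ ≡ 0ℚ

------------------------------------------------------------------------
-- Ballot sequences

-- The condition a₁ + … + aᵣ ≤ r / 2 is stated with the denominator cleared.
IsBallot : Vec (Fin 2) n → Set
IsBallot {n} α =
  ∀ r → 1 ≤ r → r ≤ n → 2 *ℕ sum (List.take r (List.map toℕ (toList α))) ≤ r

-- The proof component is irrelevant, so ballot sequences are equal as soon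
-- as the underlying 0-1 sequences are.
Ballot : ℕ → Set
Ballot n = [ α ∈ Vec (Fin 2) n ∣ IsBallot α ]

-- Reads the sequence from left to right, keeping the stack of currently
-- unmatched open parentheses (0F); each closing parenthesis (1F) is matched
-- with the most recent of these, so pairs come out in increasing order of
-- closing position.  The last clause is never reached on a ballot sequence.
matchFrom : List (Fin n) → List (Fin n × Fin 2) → List (Fin n × Fin n)
matchFrom stack       []             = []
matchFrom stack       ((i , 0F) ∷ w) = matchFrom (i ∷ stack) w
matchFrom (i ∷ stack) ((j , 1F) ∷ w) = (i , j) ∷ matchFrom stack w
matchFrom []          ((j , 1F) ∷ w) = matchFrom [] w

C : Vec (Fin 2) n → List (Fin n × Fin n)
C α = matchFrom [] (List.tabulate λ i → i , lookup α i)

Δ[_] : List (Fin n × Fin n) → R n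
Δ[ ps ] = List.foldr (λ (i , j) p → (θ j ⊖ θ i) ⊗ p) 𝟏 ps

Δ : Ballot n → R n
Δ α = Δ[ C (value α) ]

D : ∀ n → Pred (R n) 0ℓ
D n q = ∃[ α ] q ≗ Δ {n} α

------------------------------------------------------------------------
-- Linear independence of a family

LinearlyIndependent : {Ix : Set} → (Ix → R n) → Set
LinearlyIndependent {Ix = Ix} v =
  ∀ (xs : List Ix) → Unique xs → (c : Ix → ℚ) →
  ∑ xs (λ x → c x · v x) ≗ 𝟎 → ∀ {x} → x ∈ˡ xs → c x ≡ 0ℚ

{-# OPTIONS --safe #-}

-- For r ≥ 1 let F_r(∂) be the adjoint of multiplication by F_{1^r}.  Since F_{1^r}
-- commutes up to sign with every homogeneous element, an element killed by all
-- the F_r(∂) lies in EQH_n.  Let q be killed by them and involve no θ_k with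
-- i ≤ k ≤ j.  In the Leibniz rule for F_r(∂) ((θ_j - θ_i) q), the terms in which
-- θ_i is differentiated cancel those in which θ_j is: the factors of F_r(∂) that
-- would distinguish them kill q.  So (θ_j - θ_i) q is again killed by the F_r(∂),
-- and Δ_{C(α)} is built up in this way, since every pair of the matching has
-- both ends outside the interval of each pair closed earlier.
--
-- For independence, the rightmost monomial of Δ_{C(α)} is ± θ_J with J the set of
-- all closing positions, which is the set of 1s of α.

module Submission where

open import Defs
open import Data.Bool using (Bool; true; false; if_then_else_; _∨_) renaming (_≟_ to _≟ᵇ_)
open import Data.Fin as Fin using (Fin; zero; suc; toℕ; _<?_)
open import Data.Fin.Patterns using (0F; 1F)
import Data.Fin.Properties as Fin
open import Data.Fin.Subset
  using (Subset; inside; outside; ⊥; _∩_; _∪_; ∣_∣; _∈_; _∉_)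
  renaming (_-_ to _∖_)
open import Data.Fin.Subset.Properties using (_∈?_; nonempty?; p─⊥≡p; ∉⊥)
open import Data.Irrelevant using ([_])
open import Data.List as List using (List; []; _∷_; _++_; map; filter; length; reverse)
open import Data.List.Membership.Propositional using () renaming (_∈_ to _∈ˡ_)
open import Data.List.Membership.Propositional.Properties using (∈-tabulate⁺; ∈-tabulate⁻)
open import Data.List.Properties
  using (map-tabulate; length-map; length-tabulate; map-∘; map-cong;
         unfold-reverse; reverse-map; foldr-++)
open import Data.List.Relation.Unary.All as All using (All; []; _∷_)
open import Data.List.Relation.Unary.AllPairs using (AllPairs; []; _∷_)
import Data.List.Relation.Unary.AllPairs.Properties as AllPairs
open import Data.List.Relation.Unary.Any using (here; there)
open import Data.List.Relation.Unary.Unique.Propositional using (Unique)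
open import Data.Nat as ℕ using (ℕ; zero; suc; _≤_)
open import Data.Nat.Induction using (<-rec)
open import Data.Nat.ListAction using (sum)
import Data.Nat.Properties as ℕ
open import Data.Nat.Solver using () renaming (module +-*-Solver to ℕS)
open import Data.Product using (_×_; _,_; proj₁; proj₂)
open import Data.Rational using (ℚ; 0ℚ; 1ℚ; _+_; _*_; _-_; -_; 1/_; ≢-nonZero)
import Data.Rational.Properties as ℚ
open import Data.Rational.Solver using (module +-*-Solver)
open import Data.Refinement using (value; value-injective)
open import Data.Sum using (_⊎_; inj₁; inj₂)
open import Data.Vec using (Vec; []; _∷_; here; there; lookup; _[_]≔_; toList)
open import Data.Vec.Properties
  using (≡-dec; lookup⇒[]=; []=⇒lookup; []≔-updates; []≔-minimal; lookup∘update′;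
         []≔-lookup; []≔-idempotent; tabulate∘lookup; tabulate-cong)
open import Function using (_∘_; mk⇔)
open import Level using (0ℓ)
open import Relation.Binary.PropositionalEquality
open import Relation.Nullary using (¬_; does; yes; no; contradiction)
open import Relation.Nullary.Decidable using (does-⇔; dec-true; dec-false; recompute)
open import Relation.Unary using (_⊆_; Pred; Decidable)

open +-*-Solver using (solve; _:=_; _:+_; _:*_; :-_; con)

-- The algebra is done by splitting off the first variable. With p = p₀ + θ₁ p₁, the inversion signs
-- in the definition of the product collapse to the degree involution `_⋆`, and the generators,
-- their adjoints `contract` and multiplication by `θ i` obey equally short recursions; the
-- identities become inductions on the number of variables with one sign to check. This also limits
-- how much of the Leibniz rule is required: once the variables before i are stripped off, i is the
-- first variable, and from there up to j nothing occurs in q. For independence, monomials are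
-- compared by an additive weight instead of a lexicographic order. Multiplication by a variable
-- shifts all weights by the same amount, so comparing the two terms of (θ_j - θ_i) q comes down to
-- comparing two variables. The ballot condition ensures that no closing parenthesis is dropped by
-- the matching, so that the lowest monomial records every 1 of α.

private
  variable
    n : ℕ
    X Y : Set

-- Finite sums

Σ[_] : List X → (X → ℚ) → ℚ
Σ[ [] ]     f = 0ℚ
Σ[ x ∷ xs ] f = f x + Σ[ xs ] f

∑-coefficient : (xs : List X) (v : X → R n) (S : Subset n) →
                ∑ xs v S ≡ Σ[ xs ] (λ x → v x S)
∑-coefficient []       v S = refl
∑-coefficient (x ∷ xs) v S = cong (v x S +_) (∑-coefficient xs v S)

Σ-cong : (xs : List X) {f g : X → ℚ} → f ≗ g → Σ[ xs ] f ≡ Σ[ xs ] g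
Σ-cong []       f≗g = refl
Σ-cong (x ∷ xs) f≗g = cong₂ _+_ (f≗g x) (Σ-cong xs f≗g)

Σ-zero : (xs : List X) {f : X → ℚ} → (∀ x → f x ≡ 0ℚ) → Σ[ xs ] f ≡ 0ℚ
Σ-zero []       f≗0 = refl
Σ-zero (x ∷ xs) f≗0 = trans (cong₂ _+_ (f≗0 x) (Σ-zero xs f≗0)) (ℚ.+-identityˡ 0ℚ)

Σ-++ : (xs ys : List X) (f : X → ℚ) → Σ[ xs ++ ys ] f ≡ Σ[ xs ] f + Σ[ ys ] f
Σ-++ []       ys f = sym (ℚ.+-identityˡ _)
Σ-++ (x ∷ xs) ys f = trans (cong (f x +_) (Σ-++ xs ys f)) (sym (ℚ.+-assoc (f x) (Σ[ xs ] f) (Σ[ ys ] f)))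

Σ-map : (h : X → Y) (xs : List X) (f : Y → ℚ) → Σ[ map h xs ] f ≡ Σ[ xs ] (f ∘ h)
Σ-map h []       f = refl
Σ-map h (x ∷ xs) f = cong (f (h x) +_) (Σ-map h xs f)

Σ-distrib-+ : (xs : List X) (f g : X → ℚ) →
              Σ[ xs ] (λ x → f x + g x) ≡ Σ[ xs ] f + Σ[ xs ] g
Σ-distrib-+ []       f g = refl
Σ-distrib-+ (x ∷ xs) f g = trans (cong (f x + g x +_) (Σ-distrib-+ xs f g))
  (solve 4 (λ a b c d → (a :+ b) :+ (c :+ d) := (a :+ c) :+ (b :+ d)) refl
     (f x) (g x) (Σ[ xs ] f) (Σ[ xs ] g))

Σ-subsets : (f : Subset (suc n) → ℚ) →
            Σ[ subsets (suc n) ] f ≡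
            Σ[ subsets n ] (f ∘ (outside ∷_)) + Σ[ subsets n ] (f ∘ (inside ∷_))
Σ-subsets {n} f = trans (Σ-++ (map (outside ∷_) (subsets n)) _ f)
  (cong₂ _+_ (Σ-map _ (subsets n) f) (Σ-map _ (subsets n) f))

-- The product, one variable at a time

-- The halves p = p ₀ + θ₁ (p ₁) of an element, by whether θ₁ occurs.
infix 9 _₀ _₁ _⋆

_₀ _₁ : R (suc n) → R n
(p ₀) S = p (outside ∷ S)
(p ₁) S = p (inside ∷ S)

_⋆ : R n → R n
(p ⋆) S = (-1^ ∣ S ∣) * p S

-1^-+ : ∀ a b → -1^ (a ℕ.+ b) ≡ (-1^ a) * (-1^ b)
-1^-+ zero    b = sym (ℚ.*-identityˡ _)
-1^-+ (suc a) b = trans (cong -_ (-1^-+ a b)) (ℚ.neg-distribˡ-* (-1^ a) (-1^ b))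

filter-map : {P : Pred X 0ℓ} {Q : Pred Y 0ℓ} (P? : Decidable P) (Q? : Decidable Q) (h : X → Y) →
             (∀ x → does (Q? (h x)) ≡ does (P? x)) →
             ∀ xs → filter Q? (map h xs) ≡ map h (filter P? xs)
filter-map P? Q? h eq []       = refl
filter-map P? Q? h eq (x ∷ xs) rewrite eq x with does (P? x)
... | true  = cong (h x ∷_) (filter-map P? Q? h eq xs)
... | false = filter-map P? Q? h eq xs

elements-suc : ∀ b (A : Subset n) →
               filter (_∈? (b ∷ A)) (List.tabulate suc) ≡ map suc (elements A)
elements-suc {n} b A = trans (cong (filter (_∈? (b ∷ A))) (sym (map-tabulate (λ i → i) suc)))
  (filter-map (_∈? A) (_∈? (b ∷ A)) suc (λ _ → refl) (List.allFin n))

elements-outside : (A : Subset n) → elements (outside ∷ A) ≡ map suc (elements A)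
elements-outside = elements-suc outside

elements-inside : (A : Subset n) → elements (inside ∷ A) ≡ zero ∷ map suc (elements A)
elements-inside A = cong (zero ∷_) (elements-suc inside A)

length-elements : (A : Subset n) → length (elements A) ≡ ∣ A ∣
length-elements []            = refl
length-elements (outside ∷ A) rewrite elements-suc outside A =
  trans (length-map suc (elements A)) (length-elements A)
length-elements (inside ∷ A)  rewrite elements-suc inside A =
  cong suc (trans (length-map suc (elements A)) (length-elements A))

length-filter-<-suc : (i : Fin n) (xs : List (Fin n)) →
  length (filter (_<? suc i) (map suc xs)) ≡ length (filter (_<? i) xs)
length-filter-<-suc i xs = trans
  (cong length (filter-map (_<? i) (_<? suc i) suc (λ _ → refl) xs))
  (length-map suc (filter (_<? i) xs))

#below-outside : (i : Fin n) (A : Subset n) → #below (suc i) (outside ∷ A) ≡ #below i A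
#below-outside i A rewrite elements-suc outside A = length-filter-<-suc i (elements A)

#below-inside : (i : Fin n) (A : Subset n) → #below (suc i) (inside ∷ A) ≡ suc (#below i A)
#below-inside i A rewrite elements-suc inside A = cong suc (length-filter-<-suc i (elements A))

#below-zero : (A : Subset (suc n)) → #below zero A ≡ 0
#below-zero {n} A = go (elements A)
  where
  go : (xs : List (Fin (suc n))) → length (filter (_<? zero {n}) xs) ≡ 0
  go []       = refl
  go (x ∷ xs) = go xs

sum-map-suc : (f : X → ℕ) (xs : List X) → sum (map (suc ∘ f) xs) ≡ length xs ℕ.+ sum (map f xs)
sum-map-suc f []       = refl
sum-map-suc f (x ∷ xs) = cong suc (trans (cong (f x ℕ.+_) (sum-map-suc f xs))
  (ℕS.solve 3 (λ a b c → a ℕS.:+ (b ℕS.:+ c) ℕS.:= b ℕS.:+ (a ℕS.:+ c)) refl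
    (f x) (length xs) (sum (map f xs))))

sum-map-cong : {f g : X → ℕ} → f ≗ g → ∀ xs → sum (map f xs) ≡ sum (map g xs)
sum-map-cong eq xs = cong sum (map-cong eq xs)

inversions-outside : (A B : Subset n) → inversions (outside ∷ A) (outside ∷ B) ≡ inversions A B
inversions-outside A B rewrite elements-suc outside A =
  trans (cong sum (sym (map-∘ (elements A))))
    (sum-map-cong (λ i → #below-outside i B) (elements A))

inversions-insideˡ : (A B : Subset n) → inversions (inside ∷ A) (outside ∷ B) ≡ inversions A B
inversions-insideˡ A B rewrite elements-suc inside A | #below-zero (outside ∷ B) =
  trans (cong sum (sym (map-∘ (elements A))))
    (sum-map-cong (λ i → #below-outside i B) (elements A))

inversions-insideʳ : (A B : Subset n) →
                     inversions (outside ∷ A) (inside ∷ B) ≡ ∣ A ∣ ℕ.+ inversions A B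
inversions-insideʳ A B rewrite elements-suc outside A =
  trans (cong sum (sym (map-∘ (elements A))))
    (trans (sum-map-cong (λ i → #below-inside i B) (elements A))
      (trans (sum-map-suc (λ i → #below i B) (elements A))
        (cong (ℕ._+ inversions A B) (length-elements A))))

nonempty?-outside : (P : Subset n) → does (nonempty? (outside ∷ P)) ≡ does (nonempty? P)
nonempty?-outside P = does-⇔ (mk⇔ (λ { (suc i , there i∈P) → i , i∈P }) λ (i , i∈P) → suc i , there i∈P)
  (nonempty? (outside ∷ P)) (nonempty? P)

monomialProduct-outside : (A B S : Subset n) →
  monomialProduct (outside ∷ A) (outside ∷ B) (outside ∷ S) ≡ monomialProduct A B S
monomialProduct-outside A B S rewrite nonempty?-outside (A ∩ B) | inversions-outside A B
  with does (nonempty? (A ∩ B))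
... | true  = refl
... | false = refl

monomialProduct-insideˡ : (A B S : Subset n) →
  monomialProduct (inside ∷ A) (outside ∷ B) (inside ∷ S) ≡ monomialProduct A B S
monomialProduct-insideˡ A B S rewrite nonempty?-outside (A ∩ B) | inversions-insideˡ A B
  with does (nonempty? (A ∩ B))
... | true  = refl
... | false = refl

monomialProduct-insideʳ : (A B S : Subset n) →
  monomialProduct (outside ∷ A) (inside ∷ B) (inside ∷ S) ≡ (-1^ ∣ A ∣) * monomialProduct A B S
monomialProduct-insideʳ A B S rewrite nonempty?-outside (A ∩ B) | inversions-insideʳ A B
  with does (nonempty? (A ∩ B))
... | true  = sym (ℚ.*-zeroʳ (-1^ ∣ A ∣))
... | false = trans (cong (_* θ[ A ∪ B ] S) (-1^-+ ∣ A ∣ (inversions A B))) (ℚ.*-assoc (-1^ ∣ A ∣) _ _)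

θ-∪-zero : ∀ a b s (A B S : Subset n) → a ∨ b ≢ s → θ[ (a ∷ A) ∪ (b ∷ B) ] (s ∷ S) ≡ 0ℚ
θ-∪-zero false false false A B S ≢s with () ← ≢s refl
θ-∪-zero false false true  A B S ≢s = refl
θ-∪-zero false true  false A B S ≢s = refl
θ-∪-zero false true  true  A B S ≢s with () ← ≢s refl
θ-∪-zero true  b     false A B S ≢s = refl
θ-∪-zero true  b     true  A B S ≢s with () ← ≢s refl

monomialProduct-zero : ∀ a b s (A B S : Subset n) → a ∨ b ≢ s →
                       monomialProduct (a ∷ A) (b ∷ B) (s ∷ S) ≡ 0ℚ
monomialProduct-zero a b s A B S a∨b≢s with does (nonempty? ((a ∷ A) ∩ (b ∷ B)))
... | true  = refl
... | false = trans (cong ((-1^ inversions (a ∷ A) (b ∷ B)) *_) (θ-∪-zero a b s A B S a∨b≢s))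
  (ℚ.*-zeroʳ (-1^ inversions (a ∷ A) (b ∷ B)))

⊗-coefficient : (p q : R n) (S : Subset n) → (p ⊗ q) S ≡
  Σ[ subsets n ] λ A → Σ[ subsets n ] λ B → p A * q B * monomialProduct A B S
⊗-coefficient {n} p q S = trans
  (∑-coefficient (subsets n) (λ A → ∑ (subsets n) λ B → (p A * q B) · monomialProduct A B) S)
  (Σ-cong (subsets n) λ A → ∑-coefficient (subsets n) (λ B → (p A * q B) · monomialProduct A B) S)

⊗-[] : (p q : R 0) → (p ⊗ q) [] ≡ p [] * q []
⊗-[] p q = solve 2 (λ x y → x :* y :* (con 1ℚ :* con 1ℚ) :+ con 0ℚ :+ con 0ℚ := x :* y) refl
     (p []) (q [])

module _ (p q : R (suc n)) (S : Subset n) where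

  private
    term : Bool → Subset (suc n) → Subset (suc n) → ℚ
    term s A B = p A * q B * monomialProduct A B (s ∷ S)

    part : ∀ a b s → ℚ
    part a b s = Σ[ subsets n ] λ A → Σ[ subsets n ] λ B → term s (a ∷ A) (b ∷ B)

    split : ∀ s → (p ⊗ q) (s ∷ S) ≡
      (part false false s + part false true s) + (part true false s + part true true s)
    split s = trans (⊗-coefficient p q (s ∷ S))
      (trans (Σ-subsets (λ A → Σ[ subsets (suc n) ] (term s A))) (cong₂ _+_ (row false) (row true)))
      where
      row : ∀ a → (Σ[ subsets n ] λ A → Σ[ subsets (suc n) ] (term s (a ∷ A))) ≡ part a false s + part a true s
      row a = trans (Σ-cong (subsets n) λ A → Σ-subsets (term s (a ∷ A)))
        (Σ-distrib-+ (subsets n) (λ A → Σ[ subsets n ] λ B → term s (a ∷ A) (false ∷ B))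
          (λ A → Σ[ subsets n ] λ B → term s (a ∷ A) (true ∷ B)))

    part-zero : ∀ a b s → a ∨ b ≢ s → part a b s ≡ 0ℚ
    part-zero a b s ≢s = Σ-zero (subsets n) λ A → Σ-zero (subsets n) λ B →
      trans (cong (p (a ∷ A) * q (b ∷ B) *_) (monomialProduct-zero a b s A B S ≢s))
        (ℚ.*-zeroʳ (p (a ∷ A) * q (b ∷ B)))

    -- This is θ₁² = 0: both sets contain the first variable, which `nonempty?` detects by
    -- computation, so the monomial product reduces to `𝟎`.
    part-inside : part true true true ≡ 0ℚ
    part-inside = Σ-zero (subsets n) λ A → Σ-zero (subsets n) λ B → ℚ.*-zeroʳ (p (true ∷ A) * q (true ∷ B))

  ⊗-outside : (p ⊗ q) (outside ∷ S) ≡ (p ₀ ⊗ q ₀) S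
  ⊗-outside = begin
    (p ⊗ q) (outside ∷ S)
      ≡⟨ split false ⟩
    (part false false false + part false true false) + (part true false false + part true true false)
      ≡⟨ cong₂ _+_ (cong (part false false false +_) (part-zero false true false λ ()))
           (cong₂ _+_ (part-zero true false false λ ()) (part-zero true true false λ ())) ⟩
    (part false false false + 0ℚ) + (0ℚ + 0ℚ)
      ≡⟨ solve 1 (λ x → (x :+ con 0ℚ) :+ (con 0ℚ :+ con 0ℚ) := x) refl (part false false false) ⟩
    part false false false
      ≡⟨ Σ-cong (subsets n) (λ A → Σ-cong (subsets n) λ B →
           cong (p (false ∷ A) * q (false ∷ B) *_) (monomialProduct-outside A B S)) ⟩
    _
      ≡⟨ ⊗-coefficient (p ₀) (q ₀) S ⟨
    (p ₀ ⊗ q ₀) S ∎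
    where open ≡-Reasoning

  -- Expand (p₀ + θ₁ p₁)(q₀ + θ₁ q₁) and collect what contains θ₁ once. In p₀ θ₁ q₁ the variable θ₁
  -- has to be moved to the front past p₀, which changes the sign of each monomial of odd degree;
  -- `_⋆` is that change of sign.
  ⊗-inside : (p ⊗ q) (inside ∷ S) ≡ (p ₁ ⊗ q ₀) S + (p ₀ ⋆ ⊗ q ₁) S
  ⊗-inside = begin
    (p ⊗ q) (inside ∷ S)
      ≡⟨ split true ⟩
    (part false false true + part false true true) + (part true false true + part true true true)
      ≡⟨ cong₂ _+_ (cong (_+ part false true true) (part-zero false false true λ ()))
           (cong (part true false true +_) part-inside) ⟩
    (0ℚ + part false true true) + (part true false true + 0ℚ)
      ≡⟨ solve 2 (λ x y → (con 0ℚ :+ x) :+ (y :+ con 0ℚ) := y :+ x) refl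
           (part false true true) (part true false true) ⟩
    part true false true + part false true true
      ≡⟨ cong₂ _+_
           (trans (Σ-cong (subsets n) (λ A → Σ-cong (subsets n) λ B →
             cong (p (true ∷ A) * q (false ∷ B) *_) (monomialProduct-insideˡ A B S)))
             (sym (⊗-coefficient (p ₁) (q ₀) S)))
           (trans (Σ-cong (subsets n) (λ A → Σ-cong (subsets n) λ B →
             trans (cong (p (false ∷ A) * q (true ∷ B) *_) (monomialProduct-insideʳ A B S))
               (solve 4 (λ x y s m → x :* y :* (s :* m) := s :* x :* y :* m) refl
                  (p (false ∷ A)) (q (true ∷ B)) (-1^ ∣ A ∣) (monomialProduct A B S))))
             (sym (⊗-coefficient (p ₀ ⋆) (q ₁) S))) ⟩
    (p ₁ ⊗ q ₀) S + (p ₀ ⋆ ⊗ q ₁) S ∎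
    where open ≡-Reasoning

-- The inner product

Σ-θ : (f : Subset n → ℚ) (S : Subset n) → Σ[ subsets n ] (λ A → f A * θ[ A ] S) ≡ f S
Σ-θ f [] = solve 1 (λ x → x :* con 1ℚ :+ con 0ℚ := x) refl (f [])
Σ-θ {suc n} f (outside ∷ S) = trans (Σ-subsets (λ A → f A * θ[ A ] (outside ∷ S)))
  (trans (cong₂ _+_ (Σ-θ (f ₀) S) (Σ-zero (subsets n) λ A → ℚ.*-zeroʳ (f (inside ∷ A))))
    (ℚ.+-identityʳ (f (outside ∷ S))))
Σ-θ {suc n} f (inside ∷ S) = trans (Σ-subsets (λ A → f A * θ[ A ] (inside ∷ S)))
  (trans (cong₂ _+_ (Σ-zero (subsets n) λ A → ℚ.*-zeroʳ (f (outside ∷ A))) (Σ-θ (f ₁) S))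
    (ℚ.+-identityˡ (f (inside ∷ S))))

∂-coefficient : (i : Fin n) (q : R n) (S : Subset n) →
                ∂ i q S ≡ Σ[ subsets n ] λ A → q A * ∂-monomial i A S
∂-coefficient {n} i q S = ∑-coefficient (subsets n) (λ A → q A · ∂-monomial i A) S

∂-cong : (i : Fin n) {p q : R n} → p ≗ q → ∂ i p ≗ ∂ i q
∂-cong {n} i {p} {q} p≗q S = trans (∂-coefficient i p S)
  (trans (Σ-cong (subsets n) λ A → cong (_* ∂-monomial i A S) (p≗q A)) (sym (∂-coefficient i q S)))

∂-zero : (q : R (suc n)) → ∂ zero q ₀ ≗ q ₁
∂-zero {n} q S = begin
  ∂ zero q (outside ∷ S)
    ≡⟨ ∂-coefficient zero q (outside ∷ S) ⟩
  Σ[ subsets (suc n) ] (λ A → q A * ∂-monomial zero A (outside ∷ S))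
    ≡⟨ Σ-subsets (λ A → q A * ∂-monomial zero A (outside ∷ S)) ⟩
  Σ[ subsets n ] (λ A → q (outside ∷ A) * 0ℚ) + _
    ≡⟨ cong₂ _+_ (Σ-zero (subsets n) λ A → ℚ.*-zeroʳ (q (outside ∷ A)))
         (Σ-cong (subsets n) λ A → cong (q (inside ∷ A) *_) (∂-monomial-inside A)) ⟩
  0ℚ + Σ[ subsets n ] (λ A → q (inside ∷ A) * θ[ A ] S)
    ≡⟨ ℚ.+-identityˡ _ ⟩
  Σ[ subsets n ] (λ A → q (inside ∷ A) * θ[ A ] S)
    ≡⟨ Σ-θ (q ₁) S ⟩
  q (inside ∷ S) ∎
  where
  open ≡-Reasoning
  ∂-monomial-inside : ∀ A → ∂-monomial zero (inside ∷ A) (outside ∷ S) ≡ θ[ A ] S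
  ∂-monomial-inside A rewrite #below-zero (inside ∷ A) =
    trans (ℚ.*-identityˡ (θ[ (inside ∷ A) ∖ zero ] (outside ∷ S))) (cong (λ B → θ[ B ] S) (p─⊥≡p A))

∂-suc : (i : Fin n) (q : R (suc n)) → ∂ (suc i) q ₀ ≗ ∂ i (q ₀)
∂-suc {n} i q S = begin
  ∂ (suc i) q (outside ∷ S)
    ≡⟨ ∂-coefficient (suc i) q (outside ∷ S) ⟩
  Σ[ subsets (suc n) ] (λ A → q A * ∂-monomial (suc i) A (outside ∷ S))
    ≡⟨ Σ-subsets (λ A → q A * ∂-monomial (suc i) A (outside ∷ S)) ⟩
  _
    ≡⟨ cong₂ _+_ (Σ-cong (subsets n) λ A → cong (q (outside ∷ A) *_) (∂-monomial-outside A))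
         (Σ-zero (subsets n) λ A → trans (cong (q (inside ∷ A) *_) (∂-monomial-inside A))
           (ℚ.*-zeroʳ (q (inside ∷ A)))) ⟩
  Σ[ subsets n ] (λ A → q (outside ∷ A) * ∂-monomial i A S) + 0ℚ
    ≡⟨ ℚ.+-identityʳ _ ⟩
  Σ[ subsets n ] (λ A → q (outside ∷ A) * ∂-monomial i A S)
    ≡⟨ ∂-coefficient i (q ₀) S ⟨
  ∂ i (q ₀) S ∎
  where
  open ≡-Reasoning
  ∂-monomial-outside : ∀ A → ∂-monomial (suc i) (outside ∷ A) (outside ∷ S) ≡ ∂-monomial i A S
  ∂-monomial-outside A rewrite #below-outside i A with does (i ∈? A)
  ... | true  = refl
  ... | false = refl
  ∂-monomial-inside : ∀ A → ∂-monomial (suc i) (inside ∷ A) (outside ∷ S) ≡ 0ℚ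
  ∂-monomial-inside A with does (i ∈? A)
  ... | true  = ℚ.*-zeroʳ (-1^ #below (suc i) (inside ∷ A))
  ... | false = refl

∂-word-cong : (w : List (Fin n)) {p q : R n} → p ≗ q → ∂-word w p ≗ ∂-word w q
∂-word-cong []      p≗q = p≗q
∂-word-cong (i ∷ w) p≗q = ∂-cong i (∂-word-cong w p≗q)

∂-word-suc : (w : List (Fin n)) (q : R (suc n)) → ∂-word (map suc w) q ₀ ≗ ∂-word w (q ₀)
∂-word-suc []      q S = refl
∂-word-suc (i ∷ w) q S = trans (∂-suc i (∂-word (map suc w) q) S) (∂-cong i (∂-word-suc w q) S)

-- This is the orthonormality of the monomials. Reversal makes the smallest variable of A the first
-- to be differentiated, when nothing stands in front of it, so no sign arises. The halves `_₀` are
-- all that must be followed, because the coefficient at `⊥` lies in them and `∂ (suc i)` acts on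
-- them by `∂ i`.
∂-word-elements : (A : Subset n) (q : R n) → ∂-word (reverse (elements A)) q ⊥ ≡ q A
∂-word-elements []            q = refl
∂-word-elements (outside ∷ A) q = begin
  ∂-word (reverse (elements (outside ∷ A))) q ⊥
    ≡⟨ cong (λ w → ∂-word w q ⊥)
         (trans (cong reverse (elements-outside A)) (sym (reverse-map suc (elements A)))) ⟩
  ∂-word (map suc (reverse (elements A))) q ⊥
    ≡⟨ ∂-word-suc (reverse (elements A)) q ⊥ ⟩
  ∂-word (reverse (elements A)) (q ₀) ⊥
    ≡⟨ ∂-word-elements A (q ₀) ⟩
  q (outside ∷ A) ∎
  where open ≡-Reasoning
∂-word-elements (inside ∷ A) q = begin
  ∂-word (reverse (elements (inside ∷ A))) q ⊥
    ≡⟨ cong (λ w → ∂-word w q ⊥) (trans (cong reverse (elements-inside A))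
         (trans (unfold-reverse zero (map suc (elements A)))
           (cong (_++ _) (sym (reverse-map suc (elements A)))))) ⟩
  ∂-word (map suc (reverse (elements A)) ++ zero ∷ []) q ⊥
    ≡⟨ cong (λ p → p ⊥) (foldr-++ ∂ q (map suc (reverse (elements A))) (zero ∷ [])) ⟩
  ∂-word (map suc (reverse (elements A))) (∂ zero q) ⊥
    ≡⟨ ∂-word-suc (reverse (elements A)) (∂ zero q) ⊥ ⟩
  ∂-word (reverse (elements A)) (∂ zero q ₀) ⊥
    ≡⟨ ∂-word-cong (reverse (elements A)) (∂-zero q) ⊥ ⟩
  ∂-word (reverse (elements A)) (q ₁) ⊥
    ≡⟨ ∂-word-elements A (q ₁) ⟩
  q (inside ∷ A) ∎
  where open ≡-Reasoning

infix 8 _∙_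

_∙_ : R n → R n → ℚ
_∙_ {n} p q = Σ[ subsets n ] λ A → p A * q A

⟨,⟩-∙ : (p q : R n) → ⟨ p , q ⟩ ≡ p ∙ q
⟨,⟩-∙ {n} p q = trans
  (∑-coefficient (subsets n) (λ A → p A · ∂-word (reverse (elements A)) q) ⊥)
  (Σ-cong (subsets n) λ A → cong (p A *_) (∂-word-elements A q))

∙-suc : (p q : R (suc n)) → p ∙ q ≡ p ₀ ∙ q ₀ + p ₁ ∙ q ₁
∙-suc p q = Σ-subsets (λ A → p A * q A)

∙-cong : {p p′ q q′ : R n} → p ≗ p′ → q ≗ q′ → p ∙ q ≡ p′ ∙ q′
∙-cong {n} p≗p′ q≗q′ = Σ-cong (subsets n) λ A → cong₂ _*_ (p≗p′ A) (q≗q′ A)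

-- The generators of the ideal

Σ-filter : {P : Pred X 0ℓ} (P? : Decidable P) (xs : List X) (f : X → ℚ) →
           Σ[ filter P? xs ] f ≡ Σ[ xs ] λ x → (if does (P? x) then 1ℚ else 0ℚ) * f x
Σ-filter P? []       f = refl
Σ-filter P? (x ∷ xs) f with does (P? x)
... | true  = cong₂ _+_ (sym (ℚ.*-identityˡ (f x))) (Σ-filter P? xs f)
... | false = trans (Σ-filter P? xs f)
  (solve 2 (λ x s → s := con 0ℚ :* x :+ s) refl (f x)
     (Σ[ xs ] λ x → (if does (P? x) then 1ℚ else 0ℚ) * f x))

F-coefficient : ∀ r (S : Subset n) → F r S ≡ (if does (∣ S ∣ ℕ.≟ r) then 1ℚ else 0ℚ)
F-coefficient {n} r S = trans (∑-coefficient (filter (λ A → ∣ A ∣ ℕ.≟ r) (subsets n)) θ[_] S)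
  (trans (Σ-filter (λ A → ∣ A ∣ ℕ.≟ r) (subsets n) (λ A → θ[ A ] S))
    (Σ-θ (λ A → if does (∣ A ∣ ℕ.≟ r) then 1ℚ else 0ℚ) S))

F-outside : ∀ r → F {suc n} r ₀ ≗ F r
F-outside r S = trans (F-coefficient r (outside ∷ S)) (sym (F-coefficient r S))

F-inside : ∀ r → F {suc n} (suc r) ₁ ≗ F r
F-inside r S = trans (F-coefficient (suc r) (inside ∷ S)) (sym (F-coefficient r S))

-- Although `F 0` is not a generator of the ideal, it appears as soon as `F-inside` lowers the
-- degree of `F 1`.
F-zero : F {n} 0 ≗ 𝟏
F-zero {n} []            = F-coefficient {0} 0 []
F-zero {n} (outside ∷ S) = trans (F-outside 0 S) (F-zero S)
F-zero {n} (inside ∷ S)  = F-coefficient 0 (inside ∷ S)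

F-⋆ : ∀ r → F {n} r ⋆ ≗ (-1^ r) · F r
F-⋆ r S rewrite F-coefficient r S with ∣ S ∣ ℕ.≟ r
... | yes refl = refl
... | no  ∣S∣≢r rewrite dec-false (∣ S ∣ ℕ.≟ r) ∣S∣≢r = trans (ℚ.*-zeroʳ (-1^ ∣ S ∣)) (sym (ℚ.*-zeroʳ (-1^ r)))

-- Associativity and graded commutativity

-- Elements are compared pointwise, so respect for `_≗_` has to be proved along with linearity. The
-- auxiliary `f` lets a single induction give both.
Linear : ∀ {m n} → (R m → R n) → Set
Linear L = ∀ a b p q {f} → f ≗ a · p ⊕ b · q → L f ≗ a · L p ⊕ b · L q

module Linear {m n} {L : R m → R n} (linear : Linear L) where

  resp-⊕ : ∀ p q {f} → f ≗ p ⊕ q → L f ≗ L p ⊕ L q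
  resp-⊕ p q f≗ S = trans
    (linear 1ℚ 1ℚ p q (λ T → trans (f≗ T) (sym (cong₂ _+_ (ℚ.*-identityˡ (p T)) (ℚ.*-identityˡ (q T))))) S)
    (cong₂ _+_ (ℚ.*-identityˡ (L p S)) (ℚ.*-identityˡ (L q S)))

  resp-· : ∀ c p {f} → f ≗ c · p → L f ≗ c · L p
  resp-· c p f≗ S = trans
    (linear c 0ℚ p p (λ T → trans (f≗ T) (solve 2 (λ c x → c :* x := c :* x :+ con 0ℚ :* x) refl
         c (p T))) S)
    (solve 2 (λ c x → c :* x :+ con 0ℚ :* x := c :* x) refl c (L p S))

  resp-≗ : ∀ {p q} → p ≗ q → L p ≗ L q
  resp-≗ {p} {q} p≗q S = trans
    (resp-· 1ℚ q (λ T → trans (p≗q T) (sym (ℚ.*-identityˡ (q T)))) S)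
    (ℚ.*-identityˡ (L q S))

  resp-𝟎 : ∀ {f} → f ≗ 𝟎 → L f ≗ 𝟎
  resp-𝟎 f≗𝟎 S = trans (resp-· 0ℚ 𝟎 (λ T → trans (f≗𝟎 T) (sym (ℚ.*-zeroˡ 0ℚ))) S) (ℚ.*-zeroˡ (L 𝟎 S))

  resp-neg : ∀ p {f} → (∀ T → f T ≡ - p T) → ∀ S → L f S ≡ - L p S
  resp-neg p f≗ S = trans
    (resp-· (- 1ℚ) p (λ T → trans (f≗ T) (solve 1 (λ x → :- x := con (- 1ℚ) :* x) refl (p T))) S)
    (solve 1 (λ x → con (- 1ℚ) :* x := :- x) refl (L p S))

⋆-linear : Linear (_⋆ {n})
⋆-linear a b p q f≗ S = trans (cong ((-1^ ∣ S ∣) *_) (f≗ S))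
  (solve 5 (λ s a b x y → s :* (a :* x :+ b :* y) := a :* (s :* x) :+ b :* (s :* y)) refl
     (-1^ ∣ S ∣) a b (p S) (q S))

combine : ∀ a b x y x′ y′ → (a * x + b * y) + (a * x′ + b * y′) ≡ a * (x + x′) + b * (y + y′)
combine = solve 6 (λ a b x y x′ y′ →
  (a :* x :+ b :* y) :+ (a :* x′ :+ b :* y′) := a :* (x :+ x′) :+ b :* (y :+ y′)) refl

⊗-linearˡ : (g : R n) → Linear (_⊗ g)
⊗-linearˡ g a b p q {f} f≗ [] = begin
  (f ⊗ g) []                            ≡⟨ ⊗-[] f g ⟩
  f [] * g []                           ≡⟨ cong (_* g []) (f≗ []) ⟩
  (a * p [] + b * q []) * g []
    ≡⟨ solve 5 (λ a b x y z → (a :* x :+ b :* y) :* z := a :* (x :* z) :+ b :* (y :* z)) refl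
         a b (p []) (q []) (g []) ⟩
  a * (p [] * g []) + b * (q [] * g []) ≡⟨ cong₂ (λ x y → a * x + b * y) (⊗-[] p g) (⊗-[] q g) ⟨
  (a · (p ⊗ g) ⊕ b · (q ⊗ g)) []        ∎
  where open ≡-Reasoning
⊗-linearˡ g a b p q {f} f≗ (outside ∷ S) = begin
  (f ⊗ g) (outside ∷ S)                             ≡⟨ ⊗-outside f g S ⟩
  (f ₀ ⊗ g ₀) S
    ≡⟨ ⊗-linearˡ (g ₀) a b (p ₀) (q ₀) (f≗ ∘ (outside ∷_)) S ⟩
  a * (p ₀ ⊗ g ₀) S + b * (q ₀ ⊗ g ₀) S
    ≡⟨ cong₂ (λ x y → a * x + b * y) (⊗-outside p g S) (⊗-outside q g S) ⟨
  (a · (p ⊗ g) ⊕ b · (q ⊗ g)) (outside ∷ S)         ∎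
  where open ≡-Reasoning
⊗-linearˡ g a b p q {f} f≗ (inside ∷ S) = begin
  (f ⊗ g) (inside ∷ S)
    ≡⟨ ⊗-inside f g S ⟩
  (f ₁ ⊗ g ₀) S + (f ₀ ⋆ ⊗ g ₁) S
    ≡⟨ cong₂ _+_ (⊗-linearˡ (g ₀) a b (p ₁) (q ₁) (f≗ ∘ (inside ∷_)) S)
         (⊗-linearˡ (g ₁) a b (p ₀ ⋆) (q ₀ ⋆) (⋆-linear a b (p ₀) (q ₀) (f≗ ∘ (outside ∷_))) S) ⟩
  (a * (p ₁ ⊗ g ₀) S + b * (q ₁ ⊗ g ₀) S) + (a * (p ₀ ⋆ ⊗ g ₁) S + b * (q ₀ ⋆ ⊗ g ₁) S)
    ≡⟨ combine a b _ _ _ _ ⟩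
  a * ((p ₁ ⊗ g ₀) S + (p ₀ ⋆ ⊗ g ₁) S) + b * ((q ₁ ⊗ g ₀) S + (q ₀ ⋆ ⊗ g ₁) S)
    ≡⟨ cong₂ (λ x y → a * x + b * y) (⊗-inside p g S) (⊗-inside q g S) ⟨
  (a · (p ⊗ g) ⊕ b · (q ⊗ g)) (inside ∷ S) ∎
  where open ≡-Reasoning

⊗-linearʳ : (g : R n) → Linear (g ⊗_)
⊗-linearʳ g a b p q {f} f≗ [] = begin
  (g ⊗ f) []                            ≡⟨ ⊗-[] g f ⟩
  g [] * f []                           ≡⟨ cong (g [] *_) (f≗ []) ⟩
  g [] * (a * p [] + b * q [])
    ≡⟨ solve 5 (λ a b x y z → z :* (a :* x :+ b :* y) := a :* (z :* x) :+ b :* (z :* y)) refl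
         a b (p []) (q []) (g []) ⟩
  a * (g [] * p []) + b * (g [] * q []) ≡⟨ cong₂ (λ x y → a * x + b * y) (⊗-[] g p) (⊗-[] g q) ⟨
  (a · (g ⊗ p) ⊕ b · (g ⊗ q)) []        ∎
  where open ≡-Reasoning
⊗-linearʳ g a b p q {f} f≗ (outside ∷ S) = begin
  (g ⊗ f) (outside ∷ S)                             ≡⟨ ⊗-outside g f S ⟩
  (g ₀ ⊗ f ₀) S
    ≡⟨ ⊗-linearʳ (g ₀) a b (p ₀) (q ₀) (f≗ ∘ (outside ∷_)) S ⟩
  a * (g ₀ ⊗ p ₀) S + b * (g ₀ ⊗ q ₀) S
    ≡⟨ cong₂ (λ x y → a * x + b * y) (⊗-outside g p S) (⊗-outside g q S) ⟨
  (a · (g ⊗ p) ⊕ b · (g ⊗ q)) (outside ∷ S)         ∎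
  where open ≡-Reasoning
⊗-linearʳ g a b p q {f} f≗ (inside ∷ S) = begin
  (g ⊗ f) (inside ∷ S)
    ≡⟨ ⊗-inside g f S ⟩
  (g ₁ ⊗ f ₀) S + (g ₀ ⋆ ⊗ f ₁) S
    ≡⟨ cong₂ _+_ (⊗-linearʳ (g ₁) a b (p ₀) (q ₀) (f≗ ∘ (outside ∷_)) S)
         (⊗-linearʳ (g ₀ ⋆) a b (p ₁) (q ₁) (f≗ ∘ (inside ∷_)) S) ⟩
  (a * (g ₁ ⊗ p ₀) S + b * (g ₁ ⊗ q ₀) S) + (a * (g ₀ ⋆ ⊗ p ₁) S + b * (g ₀ ⋆ ⊗ q ₁) S)
    ≡⟨ combine a b _ _ _ _ ⟩
  a * ((g ₁ ⊗ p ₀) S + (g ₀ ⋆ ⊗ p ₁) S) + b * ((g ₁ ⊗ q ₀) S + (g ₀ ⋆ ⊗ q ₁) S)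
    ≡⟨ cong₂ (λ x y → a * x + b * y) (⊗-inside g p S) (⊗-inside g q S) ⟨
  (a · (g ⊗ p) ⊕ b · (g ⊗ q)) (inside ∷ S) ∎
  where open ≡-Reasoning

module ⋆ {n} = Linear (⋆-linear {n})
module ⊗ˡ {n} (g : R n) = Linear (⊗-linearˡ g)
module ⊗ʳ {n} (g : R n) = Linear (⊗-linearʳ g)

⋆-inside : (p : R (suc n)) (S : Subset n) → (p ⋆ ₁) S ≡ - (p ₁ ⋆) S
⋆-inside p S = sym (ℚ.neg-distribˡ-* (-1^ ∣ S ∣) (p (inside ∷ S)))

-- Degrees add, so the degree involution is an algebra homomorphism. Associativity rests on this,
-- because `⊗-inside` puts a `_⋆` on the left factor, which may itself be a product.
⋆-⊗ : (p q : R n) → (p ⊗ q) ⋆ ≗ p ⋆ ⊗ q ⋆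
⋆-⊗ p q [] = begin
  1ℚ * (p ⊗ q) []             ≡⟨ cong (1ℚ *_) (⊗-[] p q) ⟩
  1ℚ * (p [] * q [])
    ≡⟨ solve 2 (λ x y → con 1ℚ :* (x :* y) := (con 1ℚ :* x) :* (con 1ℚ :* y)) refl (p []) (q []) ⟩
  (p ⋆) [] * (q ⋆) []         ≡⟨ ⊗-[] (p ⋆) (q ⋆) ⟨
  (p ⋆ ⊗ q ⋆) []              ∎
  where open ≡-Reasoning
⋆-⊗ p q (outside ∷ S) = begin
  ((p ⊗ q) ⋆) (outside ∷ S)   ≡⟨ cong ((-1^ ∣ S ∣) *_) (⊗-outside p q S) ⟩
  ((p ₀ ⊗ q ₀) ⋆) S           ≡⟨ ⋆-⊗ (p ₀) (q ₀) S ⟩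
  (p ₀ ⋆ ⊗ q ₀ ⋆) S           ≡⟨ ⊗-outside (p ⋆) (q ⋆) S ⟨
  (p ⋆ ⊗ q ⋆) (outside ∷ S)   ∎
  where open ≡-Reasoning
⋆-⊗ p q (inside ∷ S) = begin
  ((p ⊗ q) ⋆) (inside ∷ S)
    ≡⟨ ⋆-inside (p ⊗ q) S ⟩
  - (((p ⊗ q) ₁) ⋆) S
    ≡⟨ cong -_ (⋆.resp-⊕ (p ₁ ⊗ q ₀) (p ₀ ⋆ ⊗ q ₁) (⊗-inside p q) S) ⟩
  - (((p ₁ ⊗ q ₀) ⋆) S + ((p ₀ ⋆ ⊗ q ₁) ⋆) S)
    ≡⟨ cong₂ (λ x y → - (x + y)) (⋆-⊗ (p ₁) (q ₀) S) (⋆-⊗ (p ₀ ⋆) (q ₁) S) ⟩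
  - ((p ₁ ⋆ ⊗ q ₀ ⋆) S + (p ₀ ⋆ ⋆ ⊗ q ₁ ⋆) S)
    ≡⟨ ℚ.neg-distrib-+ ((p ₁ ⋆ ⊗ q ₀ ⋆) S) ((p ₀ ⋆ ⋆ ⊗ q ₁ ⋆) S) ⟩
  - (p ₁ ⋆ ⊗ q ₀ ⋆) S + - (p ₀ ⋆ ⋆ ⊗ q ₁ ⋆) S
    ≡⟨ cong₂ _+_ (⊗ˡ.resp-neg (q ₀ ⋆) (p ₁ ⋆) (⋆-inside p) S) (⊗ʳ.resp-neg (p ₀ ⋆ ⋆) (q ₁ ⋆) (⋆-inside q) S) ⟨
  (p ⋆ ₁ ⊗ q ⋆ ₀) S + (p ⋆ ₀ ⋆ ⊗ q ⋆ ₁) S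
    ≡⟨ ⊗-inside (p ⋆) (q ⋆) S ⟨
  (p ⋆ ⊗ q ⋆) (inside ∷ S) ∎
  where open ≡-Reasoning

⊗-assoc : (p q t : R n) → (p ⊗ q) ⊗ t ≗ p ⊗ (q ⊗ t)
⊗-assoc p q t [] = begin
  ((p ⊗ q) ⊗ t) []       ≡⟨ ⊗-[] (p ⊗ q) t ⟩
  (p ⊗ q) [] * t []      ≡⟨ cong (_* t []) (⊗-[] p q) ⟩
  p [] * q [] * t []     ≡⟨ ℚ.*-assoc (p []) (q []) (t []) ⟩
  p [] * (q [] * t [])   ≡⟨ cong (p [] *_) (⊗-[] q t) ⟨
  p [] * (q ⊗ t) []      ≡⟨ ⊗-[] p (q ⊗ t) ⟨
  (p ⊗ (q ⊗ t)) []       ∎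
  where open ≡-Reasoning
⊗-assoc p q t (outside ∷ S) = begin
  ((p ⊗ q) ⊗ t) (outside ∷ S)   ≡⟨ ⊗-outside (p ⊗ q) t S ⟩
  ((p ⊗ q) ₀ ⊗ t ₀) S           ≡⟨ ⊗ˡ.resp-≗ (t ₀) (⊗-outside p q) S ⟩
  ((p ₀ ⊗ q ₀) ⊗ t ₀) S         ≡⟨ ⊗-assoc (p ₀) (q ₀) (t ₀) S ⟩
  (p ₀ ⊗ (q ₀ ⊗ t ₀)) S         ≡⟨ ⊗ʳ.resp-≗ (p ₀) (⊗-outside q t) S ⟨
  (p ₀ ⊗ (q ⊗ t) ₀) S           ≡⟨ ⊗-outside p (q ⊗ t) S ⟨
  (p ⊗ (q ⊗ t)) (outside ∷ S)   ∎
  where open ≡-Reasoning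
⊗-assoc p q t (inside ∷ S) = begin
  ((p ⊗ q) ⊗ t) (inside ∷ S)
    ≡⟨ ⊗-inside (p ⊗ q) t S ⟩
  ((p ⊗ q) ₁ ⊗ t ₀) S + ((p ⊗ q) ₀ ⋆ ⊗ t ₁) S
    ≡⟨ cong₂ _+_ (⊗ˡ.resp-⊕ (t ₀) (p ₁ ⊗ q ₀) (p ₀ ⋆ ⊗ q ₁) (⊗-inside p q) S)
         (⊗ˡ.resp-≗ (t ₁) (λ T → trans (⋆.resp-≗ (⊗-outside p q) T) (⋆-⊗ (p ₀) (q ₀) T)) S) ⟩
  (((p ₁ ⊗ q ₀) ⊗ t ₀) S + ((p ₀ ⋆ ⊗ q ₁) ⊗ t ₀) S) + ((p ₀ ⋆ ⊗ q ₀ ⋆) ⊗ t ₁) S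
    ≡⟨ cong₂ _+_ (cong₂ _+_ (⊗-assoc (p ₁) (q ₀) (t ₀) S) (⊗-assoc (p ₀ ⋆) (q ₁) (t ₀) S))
         (⊗-assoc (p ₀ ⋆) (q ₀ ⋆) (t ₁) S) ⟩
  ((p ₁ ⊗ (q ₀ ⊗ t ₀)) S + (p ₀ ⋆ ⊗ (q ₁ ⊗ t ₀)) S) + (p ₀ ⋆ ⊗ (q ₀ ⋆ ⊗ t ₁)) S
    ≡⟨ ℚ.+-assoc ((p ₁ ⊗ (q ₀ ⊗ t ₀)) S) ((p ₀ ⋆ ⊗ (q ₁ ⊗ t ₀)) S) ((p ₀ ⋆ ⊗ (q ₀ ⋆ ⊗ t ₁)) S) ⟩
  (p ₁ ⊗ (q ₀ ⊗ t ₀)) S + ((p ₀ ⋆ ⊗ (q ₁ ⊗ t ₀)) S + (p ₀ ⋆ ⊗ (q ₀ ⋆ ⊗ t ₁)) S)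
    ≡⟨ cong₂ _+_ (⊗ʳ.resp-≗ (p ₁) (⊗-outside q t) S)
         (⊗ʳ.resp-⊕ (p ₀ ⋆) (q ₁ ⊗ t ₀) (q ₀ ⋆ ⊗ t ₁) (⊗-inside q t) S) ⟨
  (p ₁ ⊗ (q ⊗ t) ₀) S + (p ₀ ⋆ ⊗ (q ⊗ t) ₁) S
    ≡⟨ ⊗-inside p (q ⊗ t) S ⟨
  (p ⊗ (q ⊗ t)) (inside ∷ S) ∎
  where open ≡-Reasoning

𝟏-⋆ : 𝟏 {n} ⋆ ≗ 𝟏
𝟏-⋆ []            = refl
𝟏-⋆ (outside ∷ S) = 𝟏-⋆ S
𝟏-⋆ (inside ∷ S)  = ℚ.*-zeroʳ (-1^ ∣ inside ∷ S ∣)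

⊗-identityˡ : (p : R n) → 𝟏 ⊗ p ≗ p
⊗-identityˡ p []            = trans (⊗-[] 𝟏 p) (ℚ.*-identityˡ (p []))
⊗-identityˡ p (outside ∷ S) = trans (⊗-outside 𝟏 p S) (⊗-identityˡ (p ₀) S)
⊗-identityˡ p (inside ∷ S)  = begin
  (𝟏 ⊗ p) (inside ∷ S)              ≡⟨ ⊗-inside 𝟏 p S ⟩
  (𝟎 ⊗ p ₀) S + (𝟏 ⋆ ⊗ p ₁) S
    ≡⟨ cong₂ _+_ (⊗ˡ.resp-𝟎 (p ₀) (λ _ → refl) S) (⊗ˡ.resp-≗ (p ₁) 𝟏-⋆ S) ⟩
  0ℚ + (𝟏 ⊗ p ₁) S                  ≡⟨ ℚ.+-identityˡ ((𝟏 ⊗ p ₁) S) ⟩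
  (𝟏 ⊗ p ₁) S                       ≡⟨ ⊗-identityˡ (p ₁) S ⟩
  p (inside ∷ S)                    ∎
  where open ≡-Reasoning

⊗-identityʳ : (p : R n) → p ⊗ 𝟏 ≗ p
⊗-identityʳ p []            = trans (⊗-[] p 𝟏) (ℚ.*-identityʳ (p []))
⊗-identityʳ p (outside ∷ S) = trans (⊗-outside p 𝟏 S) (⊗-identityʳ (p ₀) S)
⊗-identityʳ p (inside ∷ S)  = begin
  (p ⊗ 𝟏) (inside ∷ S)              ≡⟨ ⊗-inside p 𝟏 S ⟩
  (p ₁ ⊗ 𝟏) S + (p ₀ ⋆ ⊗ 𝟎) S
    ≡⟨ cong₂ _+_ (⊗-identityʳ (p ₁) S) (⊗ʳ.resp-𝟎 (p ₀ ⋆) (λ _ → refl) S) ⟩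
  p (inside ∷ S) + 0ℚ               ≡⟨ ℚ.+-identityʳ (p (inside ∷ S)) ⟩
  p (inside ∷ S)                    ∎
  where open ≡-Reasoning

-- The r-th power of ⋆.
twist : ℕ → R n → R n
twist r p S = (-1^ (∣ S ∣ ℕ.* r)) * p S

twist-⋆ : ∀ r (p : R n) → twist r (p ⋆) ≗ twist (suc r) p
twist-⋆ r p S = begin
  (-1^ (∣ S ∣ ℕ.* r)) * ((-1^ ∣ S ∣) * p S)
    ≡⟨ solve 3 (λ x y z → x :* (y :* z) := y :* x :* z) refl (-1^ (∣ S ∣ ℕ.* r)) (-1^ ∣ S ∣) (p S) ⟩
  (-1^ ∣ S ∣) * (-1^ (∣ S ∣ ℕ.* r)) * p S     ≡⟨ cong (_* p S) (-1^-+ ∣ S ∣ (∣ S ∣ ℕ.* r)) ⟨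
  (-1^ (∣ S ∣ ℕ.+ ∣ S ∣ ℕ.* r)) * p S         ≡⟨ cong (λ k → (-1^ k) * p S) (ℕ.*-suc ∣ S ∣ r) ⟨
  (-1^ (∣ S ∣ ℕ.* suc r)) * p S               ∎
  where open ≡-Reasoning

twist-inside : ∀ r (p : R (suc n)) → twist r p ₁ ≗ (-1^ r) · twist r (p ₁)
twist-inside r p S = trans (cong (_* p (inside ∷ S)) (-1^-+ r (∣ S ∣ ℕ.* r)))
  (ℚ.*-assoc (-1^ r) (-1^ (∣ S ∣ ℕ.* r)) (p (inside ∷ S)))

-1^-square : ∀ r x → (-1^ r) * ((-1^ r) * x) ≡ x
-1^-square zero    x = trans (ℚ.*-identityˡ (1ℚ * x)) (ℚ.*-identityˡ x)
-1^-square (suc r) x = trans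
  (solve 2 (λ s x → :- s :* (:- s :* x) := s :* (s :* x)) refl (-1^ r) x) (-1^-square r x)

-- For p homogeneous of degree d the sign is (-1) to the power d r, which `twist` applies to each
-- monomial separately. The lemma brings a generator to the front of a product in the two-sided
-- ideal.
⊗-F : ∀ (p : R n) r → p ⊗ F r ≗ F r ⊗ twist r p
⊗-F p r [] = begin
  (p ⊗ F r) []                    ≡⟨ ⊗-[] p (F r) ⟩
  p [] * F r []
    ≡⟨ solve 2 (λ x y → x :* y := y :* (con 1ℚ :* x)) refl (p []) (F r []) ⟩
  F r [] * (twist r p) []         ≡⟨ ⊗-[] (F r) (twist r p) ⟨
  (F r ⊗ twist r p) []            ∎
  where open ≡-Reasoning
⊗-F p r (outside ∷ S) = begin
  (p ⊗ F r) (outside ∷ S)         ≡⟨ ⊗-outside p (F r) S ⟩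
  (p ₀ ⊗ F r ₀) S                 ≡⟨ ⊗ʳ.resp-≗ (p ₀) (F-outside r) S ⟩
  (p ₀ ⊗ F r) S                   ≡⟨ ⊗-F (p ₀) r S ⟩
  (F r ⊗ twist r (p ₀)) S         ≡⟨ ⊗ˡ.resp-≗ (twist r (p ₀)) (F-outside r) S ⟨
  (F r ₀ ⊗ twist r (p ₀)) S       ≡⟨ ⊗-outside (F r) (twist r p) S ⟨
  (F r ⊗ twist r p) (outside ∷ S) ∎
  where open ≡-Reasoning
-- Degree 0 is treated apart because `F-inside` lowers a positive degree; here `F 0` is the unit.
⊗-F p zero (inside ∷ S) = begin
  (p ⊗ F 0) (inside ∷ S)          ≡⟨ ⊗ʳ.resp-≗ p F-zero (inside ∷ S) ⟩
  (p ⊗ 𝟏) (inside ∷ S)            ≡⟨ ⊗-identityʳ p (inside ∷ S) ⟩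
  p (inside ∷ S)
    ≡⟨ trans (cong (λ k → (-1^ k) * p (inside ∷ S)) (ℕ.*-zeroʳ ∣ inside ∷ S ∣)) (ℚ.*-identityˡ _) ⟨
  twist 0 p (inside ∷ S)          ≡⟨ ⊗-identityˡ (twist 0 p) (inside ∷ S) ⟨
  (𝟏 ⊗ twist 0 p) (inside ∷ S)    ≡⟨ ⊗ˡ.resp-≗ (twist 0 p) F-zero (inside ∷ S) ⟨
  (F 0 ⊗ twist 0 p) (inside ∷ S)  ∎
  where open ≡-Reasoning
⊗-F p (suc r) (inside ∷ S) = begin
  (p ⊗ F (suc r)) (inside ∷ S)
    ≡⟨ ⊗-inside p (F (suc r)) S ⟩
  (p ₁ ⊗ F (suc r) ₀) S + (p ₀ ⋆ ⊗ F (suc r) ₁) S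
    ≡⟨ cong₂ _+_ (⊗ʳ.resp-≗ (p ₁) (F-outside (suc r)) S) (⊗ʳ.resp-≗ (p ₀ ⋆) (F-inside r) S) ⟩
  (p ₁ ⊗ F (suc r)) S + (p ₀ ⋆ ⊗ F r) S
    ≡⟨ cong₂ _+_ (⊗-F (p ₁) (suc r) S) (⊗-F (p ₀ ⋆) r S) ⟩
  (F (suc r) ⊗ twist (suc r) (p ₁)) S + (F r ⊗ twist r (p ₀ ⋆)) S
    ≡⟨ cong₂ _+_ (sym (twisted S)) (⊗ʳ.resp-≗ (F r) (twist-⋆ r (p ₀)) S) ⟩
  (F (suc r) ₀ ⋆ ⊗ twist (suc r) p ₁) S + (F r ⊗ twist (suc r) (p ₀)) S
    ≡⟨ ℚ.+-comm ((F (suc r) ₀ ⋆ ⊗ twist (suc r) p ₁) S) ((F r ⊗ twist (suc r) (p ₀)) S) ⟩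
  (F r ⊗ twist (suc r) (p ₀)) S + (F (suc r) ₀ ⋆ ⊗ twist (suc r) p ₁) S
    ≡⟨ cong (_+ (F (suc r) ₀ ⋆ ⊗ twist (suc r) p ₁) S) (⊗ˡ.resp-≗ (twist (suc r) (p ₀)) (F-inside r) S) ⟨
  (F (suc r) ₁ ⊗ twist (suc r) p ₀) S + (F (suc r) ₀ ⋆ ⊗ twist (suc r) p ₁) S
    ≡⟨ ⊗-inside (F (suc r)) (twist (suc r) p) S ⟨
  (F (suc r) ⊗ twist (suc r) p) (inside ∷ S) ∎
  where
  open ≡-Reasoning
  -- Two equal signs cancel: one for moving θ₁ past `F (suc r)`, the other because θ₁ adds one to
  -- the degree seen by `twist`.
  twisted : F (suc r) ₀ ⋆ ⊗ twist (suc r) p ₁ ≗ F (suc r) ⊗ twist (suc r) (p ₁)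
  twisted T = begin
    (F (suc r) ₀ ⋆ ⊗ twist (suc r) p ₁) T
      ≡⟨ ⊗ˡ.resp-· (twist (suc r) p ₁) (-1^ suc r) (F (suc r))
           (λ U → trans (⋆.resp-≗ (F-outside (suc r)) U) (F-⋆ (suc r) U)) T ⟩
    (-1^ suc r) * (F (suc r) ⊗ twist (suc r) p ₁) T
      ≡⟨ cong ((-1^ suc r) *_)
           (⊗ʳ.resp-· (F (suc r)) (-1^ suc r) (twist (suc r) (p ₁)) (twist-inside (suc r) p) T) ⟩
    (-1^ suc r) * ((-1^ suc r) * (F (suc r) ⊗ twist (suc r) (p ₁)) T)
      ≡⟨ -1^-square (suc r) _ ⟩
    (F (suc r) ⊗ twist (suc r) (p ₁)) T ∎

-- Harmonic elements

Σ-linear : ∀ a b (xs : List X) (p q t : X → ℚ) {f : X → ℚ} → (∀ x → f x ≡ a * p x + b * q x) →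
           Σ[ xs ] (λ x → f x * t x) ≡ a * Σ[ xs ] (λ x → p x * t x) + b * Σ[ xs ] (λ x → q x * t x)
Σ-linear a b []       p q t f≗ = solve 2 (λ a b → con 0ℚ := a :* con 0ℚ :+ b :* con 0ℚ) refl a b
Σ-linear a b (x ∷ xs) p q t f≗ = trans
  (cong₂ _+_ (cong (_* t x) (f≗ x)) (Σ-linear a b xs p q t f≗))
  (solve 7 (λ a b y z w u v → (a :* y :+ b :* z) :* w :+ (a :* u :+ b :* v)
                           := a :* (y :* w :+ u) :+ b :* (z :* w :+ v)) refl
     a b (p x) (q x) (t x) (Σ[ xs ] λ x → p x * t x) (Σ[ xs ] λ x → q x * t x))

∙-linear : ∀ a b (p q t : R n) {f : R n} → f ≗ a · p ⊕ b · q → f ∙ t ≡ a * (p ∙ t) + b * (q ∙ t)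
∙-linear {n} a b p q t = Σ-linear a b (subsets n) p q t

∙-zeroˡ : (q : R n) → 𝟎 ∙ q ≡ 0ℚ
∙-zeroˡ {n} q = Σ-zero (subsets n) λ A → ℚ.*-zeroˡ (q A)

∙-zeroʳ : (p : R n) {q : R n} → q ≗ 𝟎 → p ∙ q ≡ 0ℚ
∙-zeroʳ {n} p q≗𝟎 = Σ-zero (subsets n) λ A → trans (cong (p A *_) (q≗𝟎 A)) (ℚ.*-zeroʳ (p A))

∙-comm : (p q : R n) → p ∙ q ≡ q ∙ p
∙-comm {n} p q = Σ-cong (subsets n) λ A → ℚ.*-comm (p A) (q A)

-- The adjoint of multiplication by F r from the left.
contract : ℕ → R n → R n
contract zero    q S             = q S
contract (suc r) q []            = 0ℚ
contract (suc r) q (outside ∷ S) = contract (suc r) (q ₀) S + contract r (q ₁) S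
contract (suc r) q (inside ∷ S)  = (-1^ suc r) * contract (suc r) (q ₁) S

contract-linear : ∀ r → Linear (contract {n} r)
contract-linear zero    a b p q f≗ S             = f≗ S
contract-linear (suc r) a b p q f≗ []            =
  solve 2 (λ a b → con 0ℚ := a :* con 0ℚ :+ b :* con 0ℚ) refl a b
contract-linear (suc r) a b p q f≗ (outside ∷ S) = trans
  (cong₂ _+_ (contract-linear (suc r) a b (p ₀) (q ₀) (f≗ ∘ (outside ∷_)) S)
             (contract-linear r a b (p ₁) (q ₁) (f≗ ∘ (inside ∷_)) S))
  (combine a b _ _ _ _)
contract-linear (suc r) a b p q f≗ (inside ∷ S)  = trans
  (cong ((-1^ suc r) *_) (contract-linear (suc r) a b (p ₁) (q ₁) (f≗ ∘ (inside ∷_)) S))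
  (solve 5 (λ s a b x y → s :* (a :* x :+ b :* y) := a :* (s :* x) :+ b :* (s :* y)) refl
     (-1^ suc r) a b (contract (suc r) (p ₁) S) (contract (suc r) (q ₁) S))

module contract {n} r = Linear (contract-linear {n} r)

-- The halves of F_{r+1} p are F_{r+1} p₀ and F_r p₀ + (-1)^{r+1} F_{r+1} p₁. Read as a two-by-two
-- block matrix acting on (p₀, p₁), its transpose gives the clauses of `contract`.
contract-adjoint : ∀ r (p q : R n) → (F r ⊗ p) ∙ q ≡ p ∙ contract r q
contract-adjoint zero p q = ∙-cong
  (λ S → trans (⊗ˡ.resp-≗ p F-zero S) (⊗-identityˡ p S)) (λ _ → refl)
contract-adjoint {zero} (suc r) p q = begin
  (F (suc r) ⊗ p) [] * q [] + 0ℚ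
    ≡⟨ cong (λ x → x * q [] + 0ℚ) (trans (⊗-[] (F (suc r)) p) (cong (_* p []) (F-coefficient (suc r) []))) ⟩
  0ℚ * p [] * q [] + 0ℚ
    ≡⟨ solve 2 (λ x y → con 0ℚ :* x :* y :+ con 0ℚ := x :* con 0ℚ :+ con 0ℚ) refl (p []) (q []) ⟩
  p [] * 0ℚ + 0ℚ                   ∎
  where open ≡-Reasoning
contract-adjoint {suc n} (suc r) p q = begin
  (F (suc r) ⊗ p) ∙ q
    ≡⟨ ∙-suc (F (suc r) ⊗ p) q ⟩
  (F (suc r) ⊗ p) ₀ ∙ q ₀ + (F (suc r) ⊗ p) ₁ ∙ q ₁
    -- The coefficients `1ℚ` here, and `0ℚ` further on, bring plain sums and single multiples into
    -- the two-term shape of the linearity lemmas.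
    ≡⟨ cong₂ _+_ (∙-cong first λ _ → refl) (∙-linear 1ℚ c (F r ⊗ p ₀) (F (suc r) ⊗ p ₁) (q ₁) second) ⟩
  (F (suc r) ⊗ p ₀) ∙ q ₀ + (1ℚ * ((F r ⊗ p ₀) ∙ q ₁) + c * ((F (suc r) ⊗ p ₁) ∙ q ₁))
    ≡⟨ cong₂ _+_ (contract-adjoint (suc r) (p ₀) (q ₀))
         (cong₂ (λ x y → 1ℚ * x + c * y)
            (contract-adjoint r (p ₀) (q ₁)) (contract-adjoint (suc r) (p ₁) (q ₁))) ⟩
  p ₀ ∙ contract (suc r) (q ₀) + (1ℚ * (p ₀ ∙ contract r (q ₁)) + c * (p ₁ ∙ contract (suc r) (q ₁)))
    ≡⟨ solve 4 (λ x y c z → x :+ (con 1ℚ :* y :+ c :* z) := (con 1ℚ :* x :+ con 1ℚ :* y) :+ (c :* z :+ con 0ℚ :* z)) refl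
         (p ₀ ∙ contract (suc r) (q ₀)) (p ₀ ∙ contract r (q ₁)) c (p ₁ ∙ contract (suc r) (q ₁)) ⟩
  (1ℚ * (p ₀ ∙ contract (suc r) (q ₀)) + 1ℚ * (p ₀ ∙ contract r (q ₁)))
    + (c * (p ₁ ∙ contract (suc r) (q ₁)) + 0ℚ * (p ₁ ∙ contract (suc r) (q ₁)))
    ≡⟨ cong₂ _+_
         (∙-linearʳ 1ℚ 1ℚ (contract (suc r) (q ₀)) (contract r (q ₁)) (p ₀)
            λ S → solve 2 (λ x y → x :+ y := con 1ℚ :* x :+ con 1ℚ :* y) refl
                    (contract (suc r) (q ₀) S) (contract r (q ₁) S))
         (∙-linearʳ c 0ℚ (contract (suc r) (q ₁)) (contract (suc r) (q ₁)) (p ₁)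
            λ S → solve 2 (λ c x → c :* x := c :* x :+ con 0ℚ :* x) refl
                 c (contract (suc r) (q ₁) S)) ⟨
  p ₀ ∙ contract (suc r) q ₀ + p ₁ ∙ contract (suc r) q ₁
    ≡⟨ ∙-suc p (contract (suc r) q) ⟨
  p ∙ contract (suc r) q ∎
  where
  open ≡-Reasoning
  c : ℚ
  c = -1^ suc r
  ∙-linearʳ : ∀ a b (u v t : R n) {f : R n} → f ≗ a · u ⊕ b · v → t ∙ f ≡ a * (t ∙ u) + b * (t ∙ v)
  ∙-linearʳ a b u v t {f} f≗ = trans (∙-comm t f) (trans (∙-linear a b u v t f≗)
    (cong₂ (λ x y → a * x + b * y) (∙-comm u t) (∙-comm v t)))
  first : (F (suc r) ⊗ p) ₀ ≗ F (suc r) ⊗ p ₀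
  first S = trans (⊗-outside (F (suc r)) p S) (⊗ˡ.resp-≗ (p ₀) (F-outside (suc r)) S)
  second : (F (suc r) ⊗ p) ₁ ≗ 1ℚ · (F r ⊗ p ₀) ⊕ c · (F (suc r) ⊗ p ₁)
  second S = trans (⊗-inside (F (suc r)) p S) (cong₂ _+_
    (trans (⊗ˡ.resp-≗ (p ₀) (F-inside r) S) (sym (ℚ.*-identityˡ _)))
    (⊗ˡ.resp-· (p ₁) c (F (suc r)) (λ T → trans (⋆.resp-≗ (F-outside (suc r)) T) (F-⋆ (suc r) T)) S))

Harmonic : R n → Set
Harmonic q = ∀ r → contract (suc r) q ≗ 𝟎

-- The statement with p multiplied on both sides is stable under the
-- generation rules of a two-sided ideal.
Harmonic⇒⊥I : {q : R n} → Harmonic q → ∀ {p} → I n p → ∀ s t → ((s ⊗ p) ⊗ t) ∙ q ≡ 0ℚ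
Harmonic⇒⊥I {q = q} h (generator (suc r) _ _) s t = trans
  -- The generator is moved in front of `s`, so that it acts by left multiplication and its adjoint
  -- can be applied to `q`.
  (∙-cong (λ S → trans (⊗ˡ.resp-≗ t (⊗-F s (suc r)) S) (⊗-assoc (F (suc r)) (twist (suc r) s) t S)) λ _ → refl)
  (trans (contract-adjoint (suc r) (twist (suc r) s ⊗ t) q) (∙-zeroʳ (twist (suc r) s ⊗ t) (h r)))
Harmonic⇒⊥I {q = q} h zero s t = trans
  (∙-cong (⊗ˡ.resp-𝟎 t (⊗ʳ.resp-𝟎 s λ _ → refl)) λ _ → refl) (∙-zeroˡ q)
Harmonic⇒⊥I {q = q} h (add {p} {p′} i i′) s t = begin
  ((s ⊗ (p ⊕ p′)) ⊗ t) ∙ q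
    ≡⟨ ∙-linear 1ℚ 1ℚ ((s ⊗ p) ⊗ t) ((s ⊗ p′) ⊗ t) q
         (⊗-linearˡ t 1ℚ 1ℚ (s ⊗ p) (s ⊗ p′) (⊗-linearʳ s 1ℚ 1ℚ p p′ λ S →
           solve 2 (λ x y → x :+ y := con 1ℚ :* x :+ con 1ℚ :* y) refl (p S) (p′ S))) ⟩
  1ℚ * (((s ⊗ p) ⊗ t) ∙ q) + 1ℚ * (((s ⊗ p′) ⊗ t) ∙ q)
    ≡⟨ cong₂ (λ x y → 1ℚ * x + 1ℚ * y) (Harmonic⇒⊥I h i s t) (Harmonic⇒⊥I h i′ s t) ⟩
  0ℚ ∎
  where open ≡-Reasoning
Harmonic⇒⊥I h (mulˡ u {p} i) s t = trans
  (∙-cong (λ S → sym (⊗ˡ.resp-≗ t (⊗-assoc s u p) S)) λ _ → refl)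
  (Harmonic⇒⊥I h i (s ⊗ u) t)
Harmonic⇒⊥I h (mulʳ u {p} i) s t = trans
  (∙-cong (λ S → trans (sym (⊗ˡ.resp-≗ t (⊗-assoc s p u) S)) (⊗-assoc (s ⊗ p) u t S)) λ _ → refl)
  (Harmonic⇒⊥I h i s (u ⊗ t))
Harmonic⇒⊥I h (resp p≗ i) s t = trans
  (∙-cong (⊗ˡ.resp-≗ t (⊗ʳ.resp-≗ s (sym ∘ p≗))) λ _ → refl)
  (Harmonic⇒⊥I h i s t)

Harmonic⇒EQH : {q : R n} → Harmonic q → EQH n q
Harmonic⇒EQH {q = q} h p i = trans (⟨,⟩-∙ p q) (trans
  (∙-cong (λ S → sym (trans (⊗-identityʳ (𝟏 ⊗ p) S) (⊗-identityˡ p S))) λ _ → refl)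
  (Harmonic⇒⊥I h i 𝟏 𝟏))

-- The Leibniz rule for contraction

-- Left multiplication by `θ i`, written coefficientwise along the same recursion as `contract` so
-- that the two can be commuted by induction; `θ-⊗` identifies it with the product.
θ· : Fin n → R n → R n
θ· zero    q (outside ∷ S) = 0ℚ
θ· zero    q (inside ∷ S)  = q (outside ∷ S)
θ· (suc i) q (outside ∷ S) = θ· i (q ₀) S
θ· (suc i) q (inside ∷ S)  = - θ· i (q ₁) S

θ·-linear : (i : Fin n) → Linear (θ· i)
θ·-linear zero    a b p q f≗ (outside ∷ S) = solve 2 (λ a b → con 0ℚ := a :* con 0ℚ :+ b :* con 0ℚ) refl
     a b
θ·-linear zero    a b p q f≗ (inside ∷ S)  = f≗ (outside ∷ S)
θ·-linear (suc i) a b p q f≗ (outside ∷ S) = θ·-linear i a b (p ₀) (q ₀) (f≗ ∘ (outside ∷_)) S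
θ·-linear (suc i) a b p q f≗ (inside ∷ S)  = trans
  (cong -_ (θ·-linear i a b (p ₁) (q ₁) (f≗ ∘ (inside ∷_)) S))
  (solve 4 (λ a b x y → :- (a :* x :+ b :* y) := a :* :- x :+ b :* :- y) refl
       a b (θ· i (p ₁) S) (θ· i (q ₁) S))

module θ· {n} (i : Fin n) = Linear (θ·-linear i)

θ-⋆ : (i : Fin n) → ∀ S → (θ i ⋆) S ≡ - θ i S
θ-⋆ zero    (outside ∷ S) = ℚ.*-zeroʳ (-1^ ∣ S ∣)
θ-⋆ zero    (inside ∷ S)  = trans (⋆-inside (θ zero) S) (cong -_ (𝟏-⋆ S))
θ-⋆ (suc i) (outside ∷ S) = θ-⋆ i S
θ-⋆ (suc i) (inside ∷ S)  = ℚ.*-zeroʳ (-1^ ∣ inside ∷ S ∣)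

θ-⊗ : (i : Fin n) (q : R n) → θ i ⊗ q ≗ θ· i q
θ-⊗ zero    q (outside ∷ S) = trans (⊗-outside (θ zero) q S) (⊗ˡ.resp-𝟎 (q ₀) (λ _ → refl) S)
θ-⊗ zero    q (inside ∷ S)  = begin
  (θ zero ⊗ q) (inside ∷ S)                   ≡⟨ ⊗-inside (θ zero) q S ⟩
  (𝟏 ⊗ q ₀) S + (θ zero ₀ ⋆ ⊗ q ₁) S          ≡⟨ cong₂ _+_ (⊗-identityˡ (q ₀) S)
                                                   (⊗ˡ.resp-𝟎 (q ₁) (⋆.resp-𝟎 λ _ → refl) S) ⟩
  q (outside ∷ S) + 0ℚ                        ≡⟨ ℚ.+-identityʳ (q (outside ∷ S)) ⟩
  q (outside ∷ S)                             ∎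
  where open ≡-Reasoning
θ-⊗ (suc i) q (outside ∷ S) = trans (⊗-outside (θ (suc i)) q S) (θ-⊗ i (q ₀) S)
θ-⊗ (suc i) q (inside ∷ S)  = begin
  (θ (suc i) ⊗ q) (inside ∷ S)                ≡⟨ ⊗-inside (θ (suc i)) q S ⟩
  (𝟎 ⊗ q ₀) S + (θ i ⋆ ⊗ q ₁) S               ≡⟨ cong₂ _+_ (⊗ˡ.resp-𝟎 (q ₀) (λ _ → refl) S)
                                                   (⊗ˡ.resp-neg (q ₁) (θ i) (θ-⋆ i) S) ⟩
  0ℚ + - (θ i ⊗ q ₁) S                        ≡⟨ ℚ.+-identityˡ (- (θ i ⊗ q ₁) S) ⟩
  - (θ i ⊗ q ₁) S                             ≡⟨ cong -_ (θ-⊗ i (q ₁) S) ⟩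
  - θ· i (q ₁) S                              ∎
  where open ≡-Reasoning

⊗-distribʳ-⊖ : (p q t : R n) → (p ⊖ q) ⊗ t ≗ (p ⊗ t) ⊖ (q ⊗ t)
⊗-distribʳ-⊖ p q t S = trans
  (⊗-linearˡ t 1ℚ (- 1ℚ) p q
     (λ T → solve 2 (λ x y → x :+ :- y := con 1ℚ :* x :+ con (- 1ℚ) :* y) refl (p T) (q T)) S)
  (solve 2 (λ x y → con 1ℚ :* x :+ con (- 1ℚ) :* y := x :+ :- y) refl ((p ⊗ t) S) ((q ⊗ t) S))

θ-diff : Fin n → Fin n → R n → R n
θ-diff i j q = θ· j q ⊖ θ· i q

Δ-∷ : (i j : Fin n) (ps : List (Fin n × Fin n)) → Δ[ (i , j) ∷ ps ] ≗ θ-diff i j Δ[ ps ]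
Δ-∷ i j ps S = trans (⊗-distribʳ-⊖ (θ j) (θ i) Δ[ ps ] S)
  (cong₂ _-_ (θ-⊗ j Δ[ ps ] S) (θ-⊗ i Δ[ ps ] S))

θ-diff-linear : (i j : Fin n) → Linear (θ-diff i j)
θ-diff-linear i j a b p q f≗ S = trans
  (cong₂ _-_ (θ·-linear j a b p q f≗ S) (θ·-linear i a b p q f≗ S))
  (solve 6 (λ a b x y u v → (a :* x :+ b :* y) :+ :- (a :* u :+ b :* v)
                         := a :* (x :+ :- u) :+ b :* (y :+ :- v)) refl
     a b (θ· j p S) (θ· j q S) (θ· i p S) (θ· i q S))

module θ-diff {n} (i j : Fin n) = Linear (θ-diff-linear i j)

infix 4 _∉var_

_∉var_ : Fin n → R n → Set
k ∉var q = ∀ S → k ∈ S → q S ≡ 0ℚ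

∉var-₀ : {k : Fin n} {q : R (suc n)} → suc k ∉var q → k ∉var q ₀
∉var-₀ k∉q S k∈S = k∉q (outside ∷ S) (there k∈S)

∉var-₁ : {k : Fin n} {q : R (suc n)} → suc k ∉var q → k ∉var q ₁
∉var-₁ k∉q S k∈S = k∉q (inside ∷ S) (there k∈S)

zero∉var : {q : R (suc n)} → zero ∉var q → q ₁ ≗ 𝟎
zero∉var 0∉q S = 0∉q (inside ∷ S) here

θ·-∉var : {k i : Fin n} {q : R n} → k ≢ i → k ∉var q → k ∉var θ· i q
θ·-∉var {k = zero}  {zero}  k≢i k∉q S             k∈S         with () ← k≢i refl
θ·-∉var {k = zero}  {suc i} k≢i k∉q (inside ∷ S)  here        = cong -_ (θ·.resp-𝟎 i (zero∉var k∉q) S)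
θ·-∉var {k = suc k} {zero}  k≢i k∉q (outside ∷ S) (there k∈S) = refl
θ·-∉var {k = suc k} {zero}  k≢i k∉q (inside ∷ S)  (there k∈S) = k∉q (outside ∷ S) (there k∈S)
θ·-∉var {k = suc k} {suc i} k≢i k∉q (outside ∷ S) (there k∈S) =
  θ·-∉var (k≢i ∘ cong suc) (∉var-₀ k∉q) S k∈S
θ·-∉var {k = suc k} {suc i} k≢i k∉q (inside ∷ S)  (there k∈S) =
  cong -_ (θ·-∉var (k≢i ∘ cong suc) (∉var-₁ k∉q) S k∈S)

contract-outside : ∀ r (q : R (suc n)) → q ₁ ≗ 𝟎 → contract r q ₀ ≗ contract r (q ₀)
contract-outside zero    q q₁≗𝟎 S = refl
contract-outside (suc r) q q₁≗𝟎 S = trans (cong (contract (suc r) (q ₀) S +_) (contract.resp-𝟎 r q₁≗𝟎 S))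
  (ℚ.+-identityʳ _)

contract-inside : ∀ r (q : R (suc n)) → q ₁ ≗ 𝟎 → contract r q ₁ ≗ 𝟎
contract-inside zero    q q₁≗𝟎 S = q₁≗𝟎 S
contract-inside (suc r) q q₁≗𝟎 S =
  trans (cong ((-1^ suc r) *_) (contract.resp-𝟎 (suc r) q₁≗𝟎 S)) (ℚ.*-zeroʳ (-1^ suc r))

-- Either θ_j is differentiated, leaving r derivatives for q, or all r + 1 derivatives move past θ_j
-- to q. In general the first kind of term has a sign for each derivative that precedes j; those
-- derivatives kill q because no variable up to j occurs in it.
contract-θ· : ∀ r (j : Fin n) (q : R n) → (∀ k → k Fin.≤ j → k ∉var q) →
  contract (suc r) (θ· j q) ≗ contract r q ⊕ (-1^ suc r) · θ· j (contract (suc r) q)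
contract-θ· r zero q free (outside ∷ S) = begin
  contract (suc r) (θ· zero q ₀) S + contract r (q ₀) S
    ≡⟨ cong₂ _+_ (contract.resp-𝟎 (suc r) (λ _ → refl) S)
         (sym (contract-outside r q (zero∉var (free zero ℕ.z≤n)) S)) ⟩
  0ℚ + contract r q (outside ∷ S)
    ≡⟨ solve 2 (λ s x → con 0ℚ :+ x := x :+ s :* con 0ℚ) refl
         (-1^ suc r) (contract r q (outside ∷ S)) ⟩
  contract r q (outside ∷ S) + (-1^ suc r) * 0ℚ ∎
  where open ≡-Reasoning
contract-θ· r zero q free (inside ∷ S) = begin
  (-1^ suc r) * contract (suc r) (q ₀) S
    ≡⟨ cong ((-1^ suc r) *_) (contract-outside (suc r) q q₁≗𝟎 S) ⟨
  (-1^ suc r) * contract (suc r) q (outside ∷ S)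
    ≡⟨ ℚ.+-identityˡ _ ⟨
  0ℚ + (-1^ suc r) * contract (suc r) q (outside ∷ S)
    ≡⟨ cong (_+ (-1^ suc r) * contract (suc r) q (outside ∷ S)) (contract-inside r q q₁≗𝟎 S) ⟨
  contract r q (inside ∷ S) + (-1^ suc r) * contract (suc r) q (outside ∷ S) ∎
  where
  open ≡-Reasoning
  q₁≗𝟎 : q ₁ ≗ 𝟎
  q₁≗𝟎 = zero∉var (free zero ℕ.z≤n)
contract-θ· r (suc j) q free (outside ∷ S) = begin
  contract (suc r) (θ· (suc j) q) (outside ∷ S)
    ≡⟨ contract-outside (suc r) (θ· (suc j) q) (λ T → cong -_ (θ·.resp-𝟎 j q₁≗𝟎 T)) S ⟩
  contract (suc r) (θ· j (q ₀)) S
    ≡⟨ contract-θ· r j (q ₀) (λ k k≤j → ∉var-₀ (free (suc k) (ℕ.s≤s k≤j))) S ⟩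
  contract r (q ₀) S + (-1^ suc r) * θ· j (contract (suc r) (q ₀)) S
    ≡⟨ cong₂ (λ x y → x + (-1^ suc r) * y) (contract-outside r q q₁≗𝟎 S)
         (θ·.resp-≗ j (contract-outside (suc r) q q₁≗𝟎) S) ⟨
  contract r q (outside ∷ S) + (-1^ suc r) * θ· j (contract (suc r) q ₀) S ∎
  where
  open ≡-Reasoning
  q₁≗𝟎 : q ₁ ≗ 𝟎
  q₁≗𝟎 = zero∉var (free zero ℕ.z≤n)
contract-θ· r (suc j) q free (inside ∷ S) = begin
  contract (suc r) (θ· (suc j) q) (inside ∷ S)
    ≡⟨ contract-inside (suc r) (θ· (suc j) q) (λ T → cong -_ (θ·.resp-𝟎 j q₁≗𝟎 T)) S ⟩
  0ℚ
    ≡⟨ solve 1 (λ s → con 0ℚ := con 0ℚ :+ s :* con 0ℚ) refl (-1^ suc r) ⟩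
  0ℚ + (-1^ suc r) * 0ℚ
    ≡⟨ cong₂ (λ x y → x + (-1^ suc r) * - y) (contract-inside r q q₁≗𝟎 S)
         (θ·.resp-𝟎 j (contract-inside (suc r) q q₁≗𝟎) S) ⟨
  contract r q (inside ∷ S) + (-1^ suc r) * - θ· j (contract (suc r) q ₁) S ∎
  where
  open ≡-Reasoning
  q₁≗𝟎 : q ₁ ≗ 𝟎
  q₁≗𝟎 = zero∉var (free zero ℕ.z≤n)

θ-diff-inside : (i j : Fin n) (q : R (suc n)) → ∀ S →
                θ-diff (suc i) (suc j) q (inside ∷ S) ≡ - θ-diff i j (q ₁) S
θ-diff-inside i j q S = solve 2 (λ x y → :- x :+ :- (:- y) := :- (x :+ :- y)) refl
     (θ· j (q ₁) S) (θ· i (q ₁) S)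

-- The factors of contract r with an index between i and j annihilate q, so the
-- terms of the Leibniz rule in which θ i or θ j is differentiated agree.
contract-θ-diff : ∀ r {i j : Fin n} (q : R n) → i Fin.< j → (∀ k → i Fin.≤ k → k Fin.≤ j → k ∉var q) →
  contract r (θ-diff i j q) ≗ (-1^ r) · θ-diff i j (contract r q)
contract-θ-diff zero q i<j free S = sym (ℚ.*-identityˡ _)
contract-θ-diff (suc r) {zero} {suc j} q i<j free (outside ∷ S) = begin
  contract (suc r) (θ-diff zero (suc j) q ₀) S + contract r (θ-diff zero (suc j) q ₁) S
    ≡⟨ cong₂ _+_ (contract.resp-≗ (suc r) (λ T → ℚ.+-identityʳ (θ· j (q ₀) T)) S)
         (contract.resp-neg r (q ₀) (λ T → trans (cong (λ x → - x - q (outside ∷ T)) (θ·.resp-𝟎 j q₁≗𝟎 T))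
           (ℚ.+-identityˡ _)) S) ⟩
  contract (suc r) (θ· j (q ₀)) S - contract r (q ₀) S
    -- With i the first variable, the rest of the interval consists of all remaining variables up to
    -- j, so `contract-θ·` applies. Its first term, from differentiating θ_j, cancels
    -- `contract r (q ₀) S`, from differentiating θ_i.
    ≡⟨ cong (_- contract r (q ₀) S) (contract-θ· r j (q ₀)
         (λ k k≤j → ∉var-₀ (free (suc k) ℕ.z≤n (ℕ.s≤s k≤j))) S) ⟩
  (contract r (q ₀) S + (-1^ suc r) * θ· j (contract (suc r) (q ₀)) S) - contract r (q ₀) S
    ≡⟨ solve 3 (λ x s y → (x :+ s :* y) :+ :- x := s :* (y :+ con 0ℚ)) refl
         (contract r (q ₀) S) (-1^ suc r) (θ· j (contract (suc r) (q ₀)) S) ⟩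
  (-1^ suc r) * (θ· j (contract (suc r) (q ₀)) S - 0ℚ)
    ≡⟨ cong (λ x → (-1^ suc r) * (x - 0ℚ)) (θ·.resp-≗ j (contract-outside (suc r) q q₁≗𝟎) S) ⟨
  (-1^ suc r) * (θ· j (contract (suc r) q ₀) S - 0ℚ) ∎
  where
  open ≡-Reasoning
  q₁≗𝟎 : q ₁ ≗ 𝟎
  q₁≗𝟎 = zero∉var (free zero ℕ.z≤n ℕ.z≤n)
contract-θ-diff (suc r) {zero} {suc j} q i<j free (inside ∷ S) = cong ((-1^ suc r) *_) (begin
  contract (suc r) (θ-diff zero (suc j) q ₁) S
    ≡⟨ contract.resp-neg (suc r) (q ₀) (λ T → trans (cong (λ x → - x - q (outside ∷ T)) (θ·.resp-𝟎 j q₁≗𝟎 T))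
         (ℚ.+-identityˡ _)) S ⟩
  - contract (suc r) (q ₀) S
    ≡⟨ cong -_ (contract-outside (suc r) q q₁≗𝟎 S) ⟨
  - contract (suc r) q (outside ∷ S)
    ≡⟨ ℚ.+-identityˡ _ ⟨
  0ℚ - contract (suc r) q (outside ∷ S)
    ≡⟨ cong (λ x → - x - contract (suc r) q (outside ∷ S)) (θ·.resp-𝟎 j (contract-inside (suc r) q q₁≗𝟎) S) ⟨
  - θ· j (contract (suc r) q ₁) S - contract (suc r) q (outside ∷ S) ∎)
  where
  open ≡-Reasoning
  q₁≗𝟎 : q ₁ ≗ 𝟎
  q₁≗𝟎 = zero∉var (free zero ℕ.z≤n ℕ.z≤n)
-- Here the first variable lies before i and may occur in q, so both halves contribute. Passing it
-- across the difference costs a sign, which makes up for the half `q ₁` meeting one derivative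
-- fewer.
contract-θ-diff (suc r) {suc i} {suc j} q (ℕ.s≤s i<j) free (outside ∷ S) = begin
  contract (suc r) (θ-diff i j (q ₀)) S + contract r (θ-diff (suc i) (suc j) q ₁) S
    ≡⟨ cong (contract (suc r) (θ-diff i j (q ₀)) S +_)
         (contract.resp-neg r (θ-diff i j (q ₁)) (θ-diff-inside i j q) S) ⟩
  contract (suc r) (θ-diff i j (q ₀)) S - contract r (θ-diff i j (q ₁)) S
    ≡⟨ cong₂ _-_ (contract-θ-diff (suc r) (q ₀) i<j
           (λ k i≤k k≤j → ∉var-₀ (free (suc k) (ℕ.s≤s i≤k) (ℕ.s≤s k≤j))) S)
         (contract-θ-diff r (q ₁) i<j (λ k i≤k k≤j → ∉var-₁ (free (suc k) (ℕ.s≤s i≤k) (ℕ.s≤s k≤j))) S) ⟩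
  (-1^ suc r) * θ-diff i j (contract (suc r) (q ₀)) S - (-1^ r) * θ-diff i j (contract r (q ₁)) S
    ≡⟨ solve 3 (λ s x y → :- s :* x :+ :- (s :* y) := :- s :* (x :+ y)) refl (-1^ r)
         (θ-diff i j (contract (suc r) (q ₀)) S) (θ-diff i j (contract r (q ₁)) S) ⟩
  (-1^ suc r) * (θ-diff i j (contract (suc r) (q ₀)) S + θ-diff i j (contract r (q ₁)) S)
    ≡⟨ cong ((-1^ suc r) *_) (θ-diff.resp-⊕ i j (contract (suc r) (q ₀)) (contract r (q ₁)) (λ _ → refl) S) ⟨
  (-1^ suc r) * θ-diff i j (contract (suc r) q ₀) S ∎
  where open ≡-Reasoning
contract-θ-diff (suc r) {suc i} {suc j} q (ℕ.s≤s i<j) free (inside ∷ S) = cong ((-1^ suc r) *_) (begin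
  contract (suc r) (θ-diff (suc i) (suc j) q ₁) S
    ≡⟨ contract.resp-neg (suc r) (θ-diff i j (q ₁)) (θ-diff-inside i j q) S ⟩
  - contract (suc r) (θ-diff i j (q ₁)) S
    ≡⟨ cong -_ (contract-θ-diff (suc r) (q ₁) i<j
         (λ k i≤k k≤j → ∉var-₁ (free (suc k) (ℕ.s≤s i≤k) (ℕ.s≤s k≤j))) S) ⟩
  - ((-1^ suc r) * θ-diff i j (contract (suc r) (q ₁)) S)
    ≡⟨ cong -_ (θ-diff.resp-· i j (-1^ suc r) (contract (suc r) (q ₁)) (λ _ → refl) S) ⟨
  - θ-diff i j (contract (suc r) q ₁) S
    ≡⟨ θ-diff-inside i j (contract (suc r) q) S ⟨
  θ-diff (suc i) (suc j) (contract (suc r) q) (inside ∷ S) ∎)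
  where open ≡-Reasoning

-- Noncrossing lists of pairs

Outside : Fin n → Fin n → Fin n → Set
Outside i j k = k Fin.< i ⊎ j Fin.< k

-- The condition depends on the order of the list: a later pair may enclose an earlier one, with its
-- ends on different sides, or lie beside it, but may not be nested inside it. In a product the head
-- is the factor multiplied on last, so the factors already present avoid its whole interval.
data Noncrossing {n} : List (Fin n × Fin n) → Set where
  []  : Noncrossing []
  _∷_ : ∀ {i j ps} → i Fin.< j × All (λ (a , b) → Outside i j a × Outside i j b) ps →
        Noncrossing ps → Noncrossing ((i , j) ∷ ps)

∉var-𝟏 : (k : Fin n) → k ∉var 𝟏
∉var-𝟏 zero    (inside ∷ S)  here        = refl
∉var-𝟏 (suc k) (outside ∷ S) (there k∈S) = ∉var-𝟏 k S k∈S
∉var-𝟏 (suc k) (inside ∷ S)  (there k∈S) = refl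

∉var-Δ : {k : Fin n} {ps : List (Fin n × Fin n)} →
         All (λ (a , b) → k ≢ a × k ≢ b) ps → k ∉var Δ[ ps ]
∉var-Δ []                               = ∉var-𝟏 _
∉var-Δ {ps = (a , b) ∷ ps} ((k≢a , k≢b) ∷ k∉) S k∈S = trans (Δ-∷ a b ps S)
  (cong₂ _-_ (θ·-∉var k≢b (∉var-Δ k∉) S k∈S) (θ·-∉var k≢a (∉var-Δ k∉) S k∈S))

Outside⇒≢ : {i j k l : Fin n} → i Fin.≤ k → k Fin.≤ j → Outside i j l → k ≢ l
Outside⇒≢ i≤k k≤j (inj₁ k<i) refl = ℕ.<⇒≱ k<i i≤k
Outside⇒≢ i≤k k≤j (inj₂ j<k) refl = ℕ.<⇒≱ j<k k≤j

𝟏-harmonic : Harmonic (𝟏 {n})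
𝟏-harmonic r []            = refl
𝟏-harmonic r (outside ∷ S) = cong₂ _+_ (𝟏-harmonic r S) (contract.resp-𝟎 r (λ _ → refl) S)
𝟏-harmonic r (inside ∷ S)  = contract-inside (suc r) 𝟏 (λ _ → refl) S

Δ-harmonic : {ps : List (Fin n × Fin n)} → Noncrossing ps → Harmonic Δ[ ps ]
Δ-harmonic []                   = 𝟏-harmonic
Δ-harmonic {ps = (i , j) ∷ ps} ((i<j , apart) ∷ noncrossing) r S = begin
  contract (suc r) Δ[ (i , j) ∷ ps ] S
    ≡⟨ contract.resp-≗ (suc r) (Δ-∷ i j ps) S ⟩
  contract (suc r) (θ-diff i j Δ[ ps ]) S
    ≡⟨ contract-θ-diff (suc r) Δ[ ps ] i<j (λ k i≤k k≤j → ∉var-Δ (All.map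
         (λ (a , b) → Outside⇒≢ i≤k k≤j a , Outside⇒≢ i≤k k≤j b) apart)) S ⟩
  (-1^ suc r) * θ-diff i j (contract (suc r) Δ[ ps ]) S
    ≡⟨ cong ((-1^ suc r) *_) (θ-diff.resp-𝟎 i j (Δ-harmonic noncrossing r) S) ⟩
  (-1^ suc r) * 0ℚ
    ≡⟨ ℚ.*-zeroʳ (-1^ suc r) ⟩
  0ℚ ∎
  where open ≡-Reasoning

-- The matching of a word

Word : ℕ → Set
Word n = List (Fin n × Fin 2)

-- A state (stack , w) of matchFrom in which the stack, read backwards, followed
-- by the positions of w is increasing.
record Increasing (stack : List (Fin n)) (w : Word n) : Set where
  constructor increasing
  field
    stack-decreasing : AllPairs Fin._>_ stack
    word-increasing  : AllPairs (λ x y → proj₁ x Fin.< proj₁ y) w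
    stack<word       : All (λ s → All (λ x → s Fin.< proj₁ x) w) stack

push : ∀ {stack} {i : Fin n} {b} {w} → Increasing stack ((i , b) ∷ w) → Increasing (i ∷ stack) w
push (increasing ss (i<w ∷ ww) sw) =
  increasing (All.map (λ { (s<i ∷ _) → s<i }) sw ∷ ss) ww (i<w ∷ All.map (λ { (_ ∷ s<w) → s<w }) sw)

pop : ∀ {stack} {i j : Fin n} {b} {w} → Increasing (i ∷ stack) ((j , b) ∷ w) → Increasing stack w
pop (increasing (_ ∷ ss) (_ ∷ ww) (_ ∷ sw)) =
  increasing ss ww (All.map (λ { (_ ∷ s<w) → s<w }) sw)

matchFrom-All : ∀ {P : Pred (Fin n) 0ℓ} {stack} {w : Word n} → All P stack → All (P ∘ proj₁) w →
                All (λ (i , j) → P i × P j) (matchFrom stack w)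
matchFrom-All {w = []}           ps       []       = []
matchFrom-All {w = (i , 0F) ∷ w} ps       (q ∷ qs) = matchFrom-All (q ∷ ps) qs
matchFrom-All {w = (j , 1F) ∷ w} []       (q ∷ qs) = matchFrom-All [] qs
matchFrom-All {w = (j , 1F) ∷ w} (p ∷ ps) (q ∷ qs) = (p , q) ∷ matchFrom-All ps qs

matchFrom-noncrossing : ∀ stack (w : Word n) → Increasing stack w → Noncrossing (matchFrom stack w)
matchFrom-noncrossing stack       []             inc = []
matchFrom-noncrossing stack       ((i , 0F) ∷ w) inc = matchFrom-noncrossing (i ∷ stack) w (push inc)
matchFrom-noncrossing []          ((j , 1F) ∷ w) (increasing [] (_ ∷ ww) []) =
  matchFrom-noncrossing [] w (increasing [] ww [])
matchFrom-noncrossing (i ∷ stack) ((j , 1F) ∷ w)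
  inc@(increasing (s<i ∷ _) (j<w ∷ _) ((i<j ∷ _) ∷ _)) =
  -- Ends of later pairs come from what remains on the stack, to the left of `i`, or from the unread
  -- letters, to the right of `j`.
  (i<j , matchFrom-All (All.map inj₁ s<i) (All.map inj₂ j<w)) ∷
  matchFrom-noncrossing stack w (pop inc)

word : Vec (Fin 2) n → Word n
word α = List.tabulate λ i → i , lookup α i

word-increasing : (α : Vec (Fin 2) n) → Increasing [] (word α)
word-increasing α = increasing [] (AllPairs.tabulate⁺-< λ i<j → i<j) []

D⊆EQH : D n ⊆ EQH n
D⊆EQH {n} {q} (α , q≗Δ) = Harmonic⇒EQH λ r S → trans (contract.resp-≗ (suc r) q≗Δ S)
  (Δ-harmonic (matchFrom-noncrossing [] (word (value α)) (word-increasing (value α))) r S)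

-- Lowest monomials

-- Earlier variables are heavier, so θ j is the lighter term of θ j - θ i for i < j.
height : Fin n → ℕ
height {suc n} zero = n
height (suc i)      = height i

-- The sum of the heights of the elements. Different sets can have the same weight; in particular
-- the last variable has height 0.
weight : Subset n → ℕ
weight []                    = 0
weight (outside ∷ S)         = weight S
weight {suc n} (inside ∷ S)  = n ℕ.+ weight S

height<n : (i : Fin n) → height i ℕ.< n
height<n zero    = ℕ.n<1+n _
height<n (suc i) = ℕ.m<n⇒m<1+n (height<n i)

height-anti-< : {i j : Fin n} → i Fin.< j → height j ℕ.< height i
height-anti-< {i = zero}  {suc j} _           = height<n j
height-anti-< {i = suc i} {suc j} (ℕ.s≤s i<j) = height-anti-< i<j

weight-remove : (i : Fin n) (S : Subset n) → i ∈ S →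
                weight S ≡ height i ℕ.+ weight (S [ i ]≔ outside)
weight-remove zero    (inside ∷ S)  here        = refl
weight-remove (suc i) (outside ∷ S) (there i∈S) = weight-remove i S i∈S
weight-remove {suc n} (suc i) (inside ∷ S) (there i∈S) = trans
  (cong (n ℕ.+_) (weight-remove i S i∈S))
  (ℕS.solve 3 (λ a b c → a ℕS.:+ (b ℕS.:+ c) ℕS.:= b ℕS.:+ (a ℕS.:+ c)) refl
     n (height i) (weight (S [ i ]≔ outside)))

weight-insert : (i : Fin n) (S : Subset n) → i ∉ S →
                weight (S [ i ]≔ inside) ≡ height i ℕ.+ weight S
weight-insert i S i∉S = trans
  (weight-remove i (S [ i ]≔ inside) ([]≔-updates S i))
  (cong (λ T → height i ℕ.+ weight T) (trans ([]≔-idempotent S i) (unchanged i S i∉S)))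
  where
  unchanged : (i : Fin n) (S : Subset n) → i ∉ S → S [ i ]≔ outside ≡ S
  unchanged zero    (outside ∷ S) i∉S = refl
  unchanged zero    (inside ∷ S)  i∉S = contradiction here i∉S
  unchanged (suc i) (s ∷ S)       i∉S = cong (s ∷_) (unchanged i S (i∉S ∘ there))

reinsert : (i : Fin n) (S : Subset n) → i ∈ S → (S [ i ]≔ outside) [ i ]≔ inside ≡ S
reinsert i S i∈S = trans ([]≔-idempotent S i)
  (trans (cong (S [ i ]≔_) (sym ([]=⇒lookup i∈S))) ([]≔-lookup S i))

θ·-vanishes : (i : Fin n) (q : R n) (S : Subset n) →
              (i ∈ S → q (S [ i ]≔ outside) ≡ 0ℚ) → θ· i q S ≡ 0ℚ
θ·-vanishes zero    q (outside ∷ S) h = refl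
θ·-vanishes zero    q (inside ∷ S)  h = h here
θ·-vanishes (suc i) q (outside ∷ S) h = θ·-vanishes i (q ₀) S (h ∘ there)
θ·-vanishes (suc i) q (inside ∷ S)  h = cong -_ (θ·-vanishes i (q ₁) S (h ∘ there))

θ·-nonzero : (i : Fin n) (q : R n) (S : Subset n) → i ∉ S → q S ≢ 0ℚ → θ· i q (S [ i ]≔ inside) ≢ 0ℚ
θ·-nonzero zero    q (outside ∷ S) i∉S qS≢0 = qS≢0
θ·-nonzero zero    q (inside ∷ S)  i∉S qS≢0 = contradiction here i∉S
θ·-nonzero (suc i) q (outside ∷ S) i∉S qS≢0 = θ·-nonzero i (q ₀) S (i∉S ∘ there) qS≢0
θ·-nonzero (suc i) q (inside ∷ S)  i∉S qS≢0 -θ≡0 = θ·-nonzero i (q ₁) S (i∉S ∘ there) qS≢0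
  (ℚ.neg-injective -θ≡0)

-- Since weights can tie, `vanishes` also excludes other monomials of the same weight as T. This
-- makes elements with different leading sets of equal weight independent of each other.
record Lowest (q : R n) (T : Subset n) : Set where
  constructor lowest
  field
    nonzero  : q T ≢ 0ℚ
    vanishes : ∀ S → S ≢ T → weight S ℕ.≤ weight T → q S ≡ 0ℚ
open Lowest

Lowest-resp : {p q : R n} {T : Subset n} → p ≗ q → Lowest q T → Lowest p T
Lowest-resp {T = T} p≗q l = lowest (nonzero l ∘ trans (sym (p≗q T)))
  λ S S≢T ≤T → trans (p≗q S) (vanishes l S S≢T ≤T)

𝟏-lowest : Lowest (𝟏 {n}) ⊥
𝟏-lowest {n} = lowest 𝟏⊥≢0 λ S S≢⊥ _ → cong (if_then 1ℚ else 0ℚ) (dec-false (≡-dec _≟ᵇ_ ⊥ S) (S≢⊥ ∘ sym))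
  where
  𝟏⊥≢0 : 𝟏 {n} ⊥ ≢ 0ℚ
  𝟏⊥≢0 𝟏⊥≡0 with () ← trans (sym (cong (if_then 1ℚ else 0ℚ) (dec-true (≡-dec _≟ᵇ_ (⊥ {n}) ⊥) refl))) 𝟏⊥≡0

-- Multiplication by a variable adds its height to every surviving monomial. As θ_i is heavier than
-- θ_j, all of θ_i q lies strictly above θ_j θ_T, which therefore survives in the difference;
-- `j ∉ T` keeps it from being zero.
θ-diff-lowest : {i j : Fin n} {q : R n} {T : Subset n} → i Fin.< j → j ∉ T →
                Lowest q T → Lowest (θ-diff i j q) (T [ j ]≔ inside)
θ-diff-lowest {i = i} {j} {q} {T} i<j j∉T l = lowest
  (λ eq → θ·-nonzero j q T j∉T (nonzero l) (trans (sym (trans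
    (cong (λ x → θ· j q T+j - x) (θ·i-vanishes T+j ℕ.≤-refl)) (ℚ.+-identityʳ _))) eq))
  (λ S S≢T+j ≤T+j → cong₂ _-_ (θ·j-vanishes S S≢T+j ≤T+j) (θ·i-vanishes S ≤T+j))
  where
  T+j = T [ j ]≔ inside

  weight-remaining : ∀ k S → k ∈ S → weight S ℕ.≤ weight T+j →
                     height k ℕ.+ weight (S [ k ]≔ outside) ℕ.≤ height j ℕ.+ weight T
  weight-remaining k S k∈S ≤T+j rewrite sym (weight-remove k S k∈S) | sym (weight-insert j T j∉T) = ≤T+j

  θ·j-vanishes : ∀ S → S ≢ T+j → weight S ℕ.≤ weight T+j → θ· j q S ≡ 0ℚ
  θ·j-vanishes S S≢T+j ≤T+j = θ·-vanishes j q S λ j∈S → vanishes l (S [ j ]≔ outside)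
    (λ eq → S≢T+j (trans (sym (reinsert j S j∈S)) (cong (_[ j ]≔ inside) eq)))
    (ℕ.+-cancelˡ-≤ (height j) _ _ (weight-remaining j S j∈S ≤T+j))

  -- The set `T+j` itself is included: trading the height of i for the smaller height of j makes the
  -- weight bound strict, so S without i is lighter than T and hence different from it.
  θ·i-vanishes : ∀ S → weight S ℕ.≤ weight T+j → θ· i q S ≡ 0ℚ
  θ·i-vanishes S ≤T+j = θ·-vanishes i q S λ i∈S →
    let <T : weight (S [ i ]≔ outside) ℕ.< weight T
        <T = ℕ.+-cancelˡ-< (height j) _ _ (ℕ.<-≤-trans
               (ℕ.+-monoˡ-< (weight (S [ i ]≔ outside)) (height-anti-< i<j)) (weight-remaining i S i∈S ≤T+j))
    in vanishes l (S [ i ]≔ outside) (λ eq → ℕ.<⇒≢ <T (cong weight eq)) (ℕ.<⇒≤ <T)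

-- The closing positions and the lowest monomial of a matching

closings : Word n → Subset n
closings []             = ⊥
closings ((i , 0F) ∷ w) = closings w
closings ((j , 1F) ∷ w) = closings w [ j ]≔ inside

∈-closings⁻ : {i : Fin n} (w : Word n) → i ∈ closings w → (i , 1F) ∈ˡ w
∈-closings⁻ {i = i} [] i∈⊥ = contradiction i∈⊥ ∉⊥
∈-closings⁻ ((j , 0F) ∷ w) i∈ = there (∈-closings⁻ w i∈)
∈-closings⁻ {i = i} ((j , 1F) ∷ w) i∈ with i Fin.≟ j
... | yes refl = here refl
... | no  i≢j  = there (∈-closings⁻ w (lookup⇒[]= i (closings w)
  (trans (sym (lookup∘update′ i≢j (closings w) inside)) ([]=⇒lookup i∈))))

∈-closings⁺ : {i : Fin n} (w : Word n) → (i , 1F) ∈ˡ w → i ∈ closings w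
∈-closings⁺ {i = i} ((j , 0F) ∷ w) (there i∈) = ∈-closings⁺ w i∈
∈-closings⁺ {i = i} ((j , 1F) ∷ w) (here refl) = []≔-updates (closings w) i
∈-closings⁺ {i = i} ((j , 1F) ∷ w) (there i∈) with i Fin.≟ j
... | yes refl = []≔-updates (closings w) i
... | no  i≢j  = []≔-minimal (closings w) i j i≢j (∈-closings⁺ w i∈)

∉-closings : {j : Fin n} {w : Word n} → All (λ x → j Fin.< proj₁ x) w → j ∉ closings w
∉-closings {w = w} j<w j∈ = ℕ.<-irrefl refl (All.lookup j<w (∈-closings⁻ w j∈))

closings-injective : {α β : Vec (Fin 2) n} → closings (word α) ≡ closings (word β) → α ≡ β
closings-injective {n} {α} {β} eq = trans (sym (tabulate∘lookup α))
  (trans (tabulate-cong (λ i → agree (closing⇒closing α β eq i) (closing⇒closing β α (sym eq) i)))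
    (tabulate∘lookup β))
  where
  closing⇒closing : ∀ (α β : Vec (Fin 2) n) → closings (word α) ≡ closings (word β) →
                    ∀ i → lookup α i ≡ 1F → lookup β i ≡ 1F
  closing⇒closing α β eq i αᵢ≡1 =
    let k , i,1≡ = ∈-tabulate⁻ {f = λ i → i , lookup β i} (∈-closings⁻ (word β)
          (subst (i ∈_) eq (∈-closings⁺ (word α) (subst (λ b → (i , b) ∈ˡ word α) αᵢ≡1 (∈-tabulate⁺ i)))))
    in trans (cong (lookup β) (cong proj₁ i,1≡)) (sym (cong proj₂ i,1≡))
  agree : {a b : Fin 2} → (a ≡ 1F → b ≡ 1F) → (b ≡ 1F → a ≡ 1F) → a ≡ b
  agree {0F} {0F} f g = refl
  agree {0F} {1F} f g = g refl
  agree {1F} {b}  f g = sym (f refl)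

bits : Word n → List ℕ
bits = map (toℕ ∘ proj₂)

-- The ballot condition for a word preceded by h unmatched open parentheses.
Balanced : ℕ → Word n → Set
Balanced h w = ∀ r → r ℕ.≤ length w → 2 ℕ.* sum (List.take r (bits w)) ℕ.≤ h ℕ.+ r

Balanced-open : ∀ {h} {i : Fin n} {w} → Balanced h ((i , 0F) ∷ w) → Balanced (suc h) w
Balanced-open {h = h} b r r≤ = ℕ.≤-trans (b (suc r) (ℕ.s≤s r≤)) (ℕ.≤-reflexive (ℕ.+-suc h r))

-- A closing letter accounts for 2 on each side of the inequality: twice its bit on the left; the
-- parenthesis it matches and its own length on the right.
Balanced-close : ∀ {h} {j : Fin n} {w} → Balanced (suc h) ((j , 1F) ∷ w) → Balanced h w
Balanced-close {h = h} {w = w} b r r≤ = ℕ.+-cancelˡ-≤ 2 _ _ (begin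
  2 ℕ.+ 2 ℕ.* s        ≡⟨ ℕ.*-suc 2 s ⟨
  2 ℕ.* suc s          ≤⟨ b (suc r) (ℕ.s≤s r≤) ⟩
  suc (h ℕ.+ suc r)    ≡⟨ cong suc (ℕ.+-suc h r) ⟩
  2 ℕ.+ (h ℕ.+ r)      ∎)
  where
  open ℕ.≤-Reasoning
  s = sum (List.take r (bits w))

Balanced-zero : {j : Fin n} {w : Word n} → ¬ Balanced 0 ((j , 1F) ∷ w)
Balanced-zero b with b 1 (ℕ.s≤s ℕ.z≤n)
... | ℕ.s≤s ()

-- The recursions of `matchFrom` and `closings` run in parallel: each closing letter j multiplies by
-- one difference and inserts j. They would part company at a closing letter read with an empty
-- stack, which the balance condition excludes.
matchFrom-lowest : ∀ stack (w : Word n) → Increasing stack w → Balanced (length stack) w →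
                   Lowest Δ[ matchFrom stack w ] (closings w)
matchFrom-lowest stack []                   inc b = 𝟏-lowest
matchFrom-lowest stack ((i , 0F) ∷ w)       inc b =
  matchFrom-lowest (i ∷ stack) w (push inc) (Balanced-open {i = i} {w} b)
matchFrom-lowest []          ((j , 1F) ∷ w) inc b = contradiction b (Balanced-zero {j = j} {w})
matchFrom-lowest (i ∷ stack) ((j , 1F) ∷ w) inc@(increasing _ (j<w ∷ _) ((i<j ∷ _) ∷ _)) b =
  Lowest-resp (Δ-∷ i j (matchFrom stack w)) (θ-diff-lowest i<j (∉-closings j<w)
    (matchFrom-lowest stack w (pop inc) (Balanced-close {j = j} {w} b)))

word-balanced : (α : Vec (Fin 2) n) → IsBallot α → Balanced 0 (word α)
word-balanced α ballot zero    _  = ℕ.z≤n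
word-balanced {n} α ballot (suc r) r≤ = subst
  (λ bs → 2 ℕ.* sum (List.take (suc r) bs) ℕ.≤ suc r) (sym bits-word)
  (ballot (suc r) (ℕ.s≤s ℕ.z≤n) (subst (suc r ℕ.≤_) (length-tabulate (λ i → i , lookup α i)) r≤))
  where
  tabulate-lookup : ∀ {n} (α : Vec (Fin 2) n) → List.tabulate (lookup α) ≡ toList α
  tabulate-lookup []      = refl
  tabulate-lookup (a ∷ α) = cong (a ∷_) (tabulate-lookup α)
  bits-word : bits (word α) ≡ map toℕ (toList α)
  bits-word = trans (map-tabulate (λ i → i , lookup α i) (toℕ ∘ proj₂))
    (trans (sym (map-tabulate (lookup α) toℕ)) (cong (map toℕ) (tabulate-lookup α)))

Δ-lowest : (α : Ballot n) → Lowest (Δ α) (closings (word (value α)))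
Δ-lowest record { value = α ; proof = [ ballot ] } = matchFrom-lowest [] (word α) (word-increasing α)
  -- The ballot proof is irrelevant data; each inequality is recovered from it because the order on
  -- ℕ is decidable.
  (word-balanced α λ r 1≤r r≤n → recompute (_ ℕ.≤? r) (ballot r 1≤r r≤n))

-- Linear independence from distinct lowest monomials

Σ-zero-∈ : (xs : List X) {f : X → ℚ} → (∀ {x} → x ∈ˡ xs → f x ≡ 0ℚ) → Σ[ xs ] f ≡ 0ℚ
Σ-zero-∈ []       f≡0 = refl
Σ-zero-∈ (x ∷ xs) f≡0 = cong₂ _+_ (f≡0 (here refl)) (Σ-zero-∈ xs (f≡0 ∘ there))

Σ-single : {xs : List X} {x : X} {f : X → ℚ} → Unique xs → x ∈ˡ xs →
           (∀ {y} → y ∈ˡ xs → y ≢ x → f y ≡ 0ℚ) → Σ[ xs ] f ≡ f x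
Σ-single {xs = x ∷ xs} {f = f} (x≢xs ∷ _) (here refl) f≡0 = trans
  (cong (f x +_) (Σ-zero-∈ xs λ y∈xs → f≡0 (there y∈xs) (All.lookup x≢xs y∈xs ∘ sym)))
  (ℚ.+-identityʳ (f x))
Σ-single {xs = y ∷ xs} {x} {f} (y≢xs ∷ unique) (there x∈xs) f≡0 = trans
  (cong₂ _+_ (f≡0 (here refl) (All.lookup y≢xs x∈xs)) (Σ-single unique x∈xs (f≡0 ∘ there)))
  (ℚ.+-identityˡ (f x))

*-zero-cancelʳ : ∀ p q → q ≢ 0ℚ → p * q ≡ 0ℚ → p ≡ 0ℚ
*-zero-cancelʳ p q q≢0 pq≡0 = begin
  p                 ≡⟨ ℚ.*-identityʳ p ⟨
  p * 1ℚ            ≡⟨ cong (p *_) (ℚ.*-inverseʳ q) ⟨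
  p * (q * 1/ q)    ≡⟨ ℚ.*-assoc p q (1/ q) ⟨
  p * q * 1/ q      ≡⟨ cong (_* 1/ q) pq≡0 ⟩
  0ℚ * 1/ q         ≡⟨ ℚ.*-zeroˡ (1/ q) ⟩
  0ℚ                ∎
  where
  open ≡-Reasoning
  instance q-nonZero = ≢-nonZero q≢0

-- Triangularity, by strong induction on the weight of `lead x`: in the coefficient of the relation
-- at `lead x`, indices with lighter leads have coefficient 0 by induction, and the other indices
-- different from x have no such monomial.
Lowest⇒independent : {Ix : Set} (v : Ix → R n) (lead : Ix → Subset n) →
  (∀ {x y} → lead x ≡ lead y → x ≡ y) → (∀ x → Lowest (v x) (lead x)) → LinearlyIndependent v
Lowest⇒independent v lead lead-injective v-lowest xs unique c ∑≗𝟎 {x} =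
  <-rec (λ k → ∀ x → weight (lead x) ≡ k → x ∈ˡ xs → c x ≡ 0ℚ) step (weight (lead x)) x refl
  where
  step : ∀ k → (∀ {l} → l ℕ.< k → ∀ y → weight (lead y) ≡ l → y ∈ˡ xs → c y ≡ 0ℚ) →
         ∀ x → weight (lead x) ≡ k → x ∈ˡ xs → c x ≡ 0ℚ
  step _ ih x refl x∈xs = *-zero-cancelʳ (c x) (v x (lead x)) (nonzero (v-lowest x))
    (trans (sym (Σ-single unique x∈xs others))
      (trans (sym (∑-coefficient xs (λ y → c y · v y) (lead x))) (∑≗𝟎 (lead x))))
    where
    others : ∀ {y} → y ∈ˡ xs → y ≢ x → c y * v y (lead x) ≡ 0ℚ
    others {y} y∈xs y≢x with weight (lead y) ℕ.<? weight (lead x)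
    ... | yes y<x = trans (cong (_* v y (lead x)) (ih y<x y refl y∈xs)) (ℚ.*-zeroˡ (v y (lead x)))
    -- This case includes ties in weight; injectivity of `lead` then supplies the inequality of sets
    -- that `vanishes` asks for.
    ... | no  y≮x = trans (cong (c y *_)
      (vanishes (v-lowest y) (lead x) (y≢x ∘ sym ∘ lead-injective) (ℕ.≮⇒≥ y≮x))) (ℚ.*-zeroʳ (c y))

proposition2p10 : ∀ (n : ℕ) → 1 ≤ n → (D n ⊆ EQH n) × LinearlyIndependent (Δ {n})
proposition2p10 n 1≤n = D⊆EQH , Lowest⇒independent Δ (closings ∘ word ∘ value)
  (value-injective ∘ closings-injective) Δ-lowest
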